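{- For the $5\times 3$ case, $z_{wL}(5,3)\ge 10$, and hence $\mathrm{BSR}(5,3)\ge 10$.
   Context: Notation: $[m]=\{1,\dots,m\}$. An $m\times n$ biquadratic form is a real polynomial $P(\mathbf{x},\mathbf{y})=\sum_{i,k=1}^m\sum_{j,l=1}^n a_{ijkl}x_ix_ky_jy_l$ (with $a_{ijkl}=a_{kjil}=a_{klij}$). It is SOS if $P=\sum_{p=1}^r f_p^2$ with each $f_p$ a real bilinear form in $(\mathbf{x},\mathbf{y})$; the minimum such $r$ is its SOS rank $\mathrm{SOS}(P)$. $\mathrm{BSR}(m,n)$ is the maximum SOS rank among all $m\times n$ SOS biquadratic forms. $z(m,n)$ (the Zarankiewicz number) is the maximum number of edges of an $m\times n$ bipartite graph with no $C_4$. Augmented bipartite graphs $G=(S,T,E_1\cup E_2)$, $S=[m]$, $T=[n]$. A cell is a pair $(i,j)\in[m]\times[n]$ ($i$ is its row, $j$ its column). A 1-edge is a cell; $E_1$ is a set of 1-edges, viewed as a bipartite graph $G_1$ on $S,T$. A 2-edge is an unordered pair of distinct cells, written $(i,j;k,l)$; the cells $(i,j)$ and $(k,l)$ are its two halves. It is nondegenerate if $i\ne k$ and $j\ne l$, row-degenerate if $i=k$ and $j\neq l$, column-degenerate if $i\ne k$ and $j=l$. $E_2$ is a set of 2-edges. A cell is occupied if it is in $E_1$ or is a half of some 2-edge in $E_2$; otherwise it is unoccupied. The opposite cells of a nondegenerate 2-edge $(i,j;k,l)$ are $(i,l)$ and $(k,j)$. Two nondegenerate 2-edges of the form $(i,j;k,l)$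 and $(i,l;k,j)$ are called complementary. The dependency graph $\mathcal{D}$ is the directed graph whose vertices are the nondegenerate 2-edges in $E_2$, with an arc $e\to e'$ ($e\ne e'$) if both opposite cells of $e$ are occupied and one half of $e'$ is an opposite cell of $e$. An edge's row (column) set is the set of rows (columns) of its cell (1-edge) or of its halves (2-edge). Two edges are vertex-disjoint if their row sets are disjoint and their column sets are disjoint. The opposite cells of a vertex-disjoint pair $e,f$ are the cells formed by a row of one of the two edges and a column of the other. For a 1-edge $(i,j)$ and a 2-edge $(k,l;p,q)$ they are $(i,l),(i,q),(k,j),(p,j)$. Conditions: (S) No 2-edge shares a cell with any 1-edge or with any other 2-edge. (W1) $G_1$ contains no $C_4$. (W2) $\mathcal{D}$ contains no directed cycle other than 2-cycles formed by a pair of complementary 2-edges (which are allowed). (W2') There is no nondegenerate 2-edge in $E_2$ whose two opposite cells are both 1-edges. (W3) For every vertex-disjoint pair of edges of $G$ at least one of which is a 2-edge, at least one of the opposite cells of the pair is unoccupied. $z_{wL}(m,n)$ is the maximum of $|E_1|+|E_2|$ over all $G$ satisfying (S), (W1), (W2), (W2'), (W3) and $|E_1|=z(m,n)$. -}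

module Defs where

open import Level using (0ℓ)
open import Algebra.Bundles.Raw using (RawMonoid)
import Algebra.Definitions.RawMonoid as RawMonoidDefinitions
open import Data.Nat.Base as ℕ using (ℕ; _⊔_)
import Data.Nat.Properties as ℕ
open import Data.Fin.Base as Fin using (Fin)
open import Data.List.Base using (List; []; _∷_; _++_; _∷ʳ_; map; length)
open import Data.List.Membership.Propositional using (_∈_; _∉_)
open import Data.List.Relation.Binary.Disjoint.Propositional using (Disjoint)
open import Data.List.Relation.Unary.All using (All)
open import Data.List.Relation.Unary.Any using (Any)
open import Data.List.Relation.Unary.Linked using (Linked)
open import Data.List.Relation.Unary.Unique.Propositional using (Unique)
open import Data.Product.Base using (∃-syntax; Σ-syntax; _×_; _,_; proj₁; proj₂)
open import Data.Product.Relation.Binary.Lex.Strict using (×-Lex)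
open import Data.Rational.Base as ℚ using (ℚ; 0ℚ; 1ℚ; ½; ∣_∣; 1/_)
import Data.Rational.Properties as ℚ
import Data.Rational.Solver as ℚ
open import Data.Sum.Base using (_⊎_)
open import Data.Vec.Functional using (Vector)
open import Function.Bundles using (_⇔_; mk⇔)
open import Relation.Binary.PropositionalEquality
  using (_≡_; _≢_; refl; sym; trans; cong; subst; module ≡-Reasoning)
open import Relation.Nullary using (¬_)
open import Relation.Unary using (Pred)

IsMaximum : Pred ℕ 0ℓ → Pred ℕ 0ℓ
IsMaximum A k = A k × (∀ j → A j → j ℕ.≤ k)

IsMinimum : Pred ℕ 0ℓ → Pred ℕ 0ℓ
IsMinimum A k = A k × (∀ j → A j → k ℕ.≤ j)

-- "k ≤ max A".  The maximum of a bounded inhabited set need not be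
-- computable, so it is not named; ≤max⇔ justifies the reading.

_≤max_ : ℕ → Pred ℕ 0ℓ → Set
k ≤max A = ∃[ a ] A a × k ℕ.≤ a

≤max⇔ : ∀ {A b} → IsMaximum A b → ∀ {k} → k ≤max A ⇔ k ℕ.≤ b
≤max⇔ (Ab , ub) = mk⇔ (λ (a , Aa , k≤a) → ℕ.≤-trans k≤a (ub a Aa))
                      (λ k≤b → _ , Ab , k≤b)

-- The real numbers: Cauchy sequences of rationals, with two sequences
-- equal when their difference tends to 0

IsCauchy : (ℕ → ℚ) → Set
IsCauchy s = ∀ ε → 0ℚ ℚ.< ε →
  ∃[ N ] ∀ m n → N ℕ.≤ m → N ℕ.≤ n → ∣ s m ℚ.- s n ∣ ℚ.< ε

record ℝ : Set where
  constructor mkℝ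
  field
    seq    : ℕ → ℚ
    cauchy : IsCauchy seq

open ℝ public

infix 4 _≈_
record _≈_ (x y : ℝ) : Set where
  constructor mk≈
  field
    close : ∀ ε → 0ℚ ℚ.< ε →
      ∃[ N ] ∀ n → N ℕ.≤ n → ∣ seq x n ℚ.- seq y n ∣ ℚ.< ε

open _≈_ public

fromℚ : ℚ → ℝ
fromℚ q = mkℝ (λ _ → q) λ ε 0<ε → 0 , λ _ _ _ _ →
  subst (λ d → ∣ d ∣ ℚ.< ε) (sym (ℚ.+-inverseʳ q)) 0<ε

0ℝ : ℝ
0ℝ = fromℚ 0ℚ

private
  *-pos : ∀ {p q} → 0ℚ ℚ.< p → 0ℚ ℚ.< q → 0ℚ ℚ.< p ℚ.* q
  *-pos {p} {q} 0<p 0<q =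
    subst (ℚ._< p ℚ.* q) (ℚ.*-zeroʳ p) (ℚ.*-monoʳ-<-pos p {{ℚ.positive 0<p}} 0<q)

  half+half : ∀ ε → ε ℚ.* ½ ℚ.+ ε ℚ.* ½ ≡ ε
  half+half ε = trans (sym (ℚ.*-distribˡ-+ ε ½ ½)) (ℚ.*-identityʳ ε)

  0<half : ∀ {ε} → 0ℚ ℚ.< ε → 0ℚ ℚ.< ε ℚ.* ½
  0<half 0<ε = *-pos 0<ε (ℚ.positive⁻¹ ½)

  bounded : ∀ s → IsCauchy s →
    ∃[ N ] ∃[ B ] 0ℚ ℚ.< B × (∀ n → N ℕ.≤ n → ∣ s n ∣ ℚ.≤ B)
  bounded s c with c 1ℚ (ℚ.positive⁻¹ 1ℚ)
  ... | N , close = N , 1ℚ ℚ.+ ∣ s N ∣ , 0<B , λ n N≤n → begin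
      ∣ s n ∣                        ≡⟨ cong ∣_∣ (split (s n) (s N)) ⟩
      ∣ (s n ℚ.- s N) ℚ.+ s N ∣      ≤⟨ ℚ.∣p+q∣≤∣p∣+∣q∣ (s n ℚ.- s N) (s N) ⟩
      ∣ s n ℚ.- s N ∣ ℚ.+ ∣ s N ∣    ≤⟨ ℚ.+-monoˡ-≤ ∣ s N ∣
                                         (ℚ.<⇒≤ (close n N N≤n ℕ.≤-refl)) ⟩
      1ℚ ℚ.+ ∣ s N ∣                 ∎
    where
    open ℚ.≤-Reasoning
    open ℚ.+-*-Solver
    split : ∀ a b → a ≡ (a ℚ.- b) ℚ.+ b
    split = solve 2 (λ a b → a := (a :- b) :+ b) refl
    0<B : 0ℚ ℚ.< 1ℚ ℚ.+ ∣ s N ∣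
    0<B = ℚ.+-mono-<-≤ (ℚ.positive⁻¹ 1ℚ) (ℚ.0≤∣p∣ (s N))

  divide : ∀ {D ε} → 0ℚ ℚ.< D → 0ℚ ℚ.< ε → ∃[ δ ] 0ℚ ℚ.< δ × D ℚ.* δ ≡ ε
  divide {D} {ε} 0<D 0<ε = D⁻¹ ℚ.* ε , *-pos 0<D⁻¹ 0<ε , (begin
      D ℚ.* (D⁻¹ ℚ.* ε)    ≡⟨ ℚ.*-assoc D D⁻¹ ε ⟨
      D ℚ.* D⁻¹ ℚ.* ε      ≡⟨ cong (ℚ._* ε) (ℚ.*-inverseʳ D {{D≢0}}) ⟩
      1ℚ ℚ.* ε             ≡⟨ ℚ.*-identityˡ ε ⟩
      ε                    ∎)
    where
    open ≡-Reasoning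
    D≢0 : ℚ.NonZero D
    D≢0 = ℚ.pos⇒nonZero D {{ℚ.positive 0<D}}
    D⁻¹ : ℚ
    D⁻¹ = (1/ D) {{D≢0}}
    0<D⁻¹ : 0ℚ ℚ.< D⁻¹
    0<D⁻¹ = ℚ.positive⁻¹ D⁻¹ {{ℚ.1/pos⇒pos D {{ℚ.positive 0<D}}}}

  scale : ∀ {p q D δ} → 0ℚ ℚ.< D → ∣ p ∣ ℚ.≤ D → ∣ q ∣ ℚ.< δ →
    ∣ p ℚ.* q ∣ ℚ.< D ℚ.* δ
  scale {p} {q} {D} {δ} 0<D p≤D q<δ = begin-strict
    ∣ p ℚ.* q ∣        ≡⟨ ℚ.∣p*q∣≡∣p∣*∣q∣ p q ⟩
    ∣ p ∣ ℚ.* ∣ q ∣    ≤⟨ ℚ.*-monoʳ-≤-nonNeg ∣ q ∣ {{ℚ.∣-∣-nonNeg q}} p≤D ⟩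
    D ℚ.* ∣ q ∣        <⟨ ℚ.*-monoʳ-<-pos D {{ℚ.positive 0<D}} q<δ ⟩
    D ℚ.* δ            ∎
    where open ℚ.≤-Reasoning

  product-close : ∀ a b c d {B C δ ε} → 0ℚ ℚ.< B → 0ℚ ℚ.< C →
    (B ℚ.+ C) ℚ.* δ ≡ ε → ∣ a ∣ ℚ.≤ B → ∣ d ∣ ℚ.≤ C →
    ∣ a ℚ.- c ∣ ℚ.< δ → ∣ b ℚ.- d ∣ ℚ.< δ →
    ∣ a ℚ.* b ℚ.- c ℚ.* d ∣ ℚ.< ε
  product-close a b c d {B} {C} {δ} {ε} 0<B 0<C eq a≤B d≤C ac bd =
    begin-strict
    ∣ a ℚ.* b ℚ.- c ℚ.* d ∣
      ≡⟨ cong ∣_∣ (regroup a b c d) ⟩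
    ∣ a ℚ.* (b ℚ.- d) ℚ.+ d ℚ.* (a ℚ.- c) ∣
      ≤⟨ ℚ.∣p+q∣≤∣p∣+∣q∣ (a ℚ.* (b ℚ.- d)) (d ℚ.* (a ℚ.- c)) ⟩
    ∣ a ℚ.* (b ℚ.- d) ∣ ℚ.+ ∣ d ℚ.* (a ℚ.- c) ∣
      <⟨ ℚ.+-mono-< (scale {a} {b ℚ.- d} 0<B a≤B bd) (scale {d} {a ℚ.- c} 0<C d≤C ac) ⟩
    B ℚ.* δ ℚ.+ C ℚ.* δ
      ≡⟨ ℚ.*-distribʳ-+ δ B C ⟨
    (B ℚ.+ C) ℚ.* δ
      ≡⟨ eq ⟩
    ε ∎
    where
    open ℚ.≤-Reasoning
    open ℚ.+-*-Solver
    regroup : ∀ a b c d → a ℚ.* b ℚ.- c ℚ.* d ≡ a ℚ.* (b ℚ.- d) ℚ.+ d ℚ.* (a ℚ.- c)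
    regroup = solve 4 (λ a b c d →
      a :* b :- c :* d := a :* (b :- d) :+ d :* (a :- c)) refl

infixl 6 _+_
infixl 7 _*_

_+_ : ℝ → ℝ → ℝ
seq (x + y) n = seq x n ℚ.+ seq y n
cauchy (x + y) ε 0<ε
  with cauchy x (ε ℚ.* ½) (0<half 0<ε) | cauchy y (ε ℚ.* ½) (0<half 0<ε)
... | M , p | N , q = M ⊔ N , λ m n M⊔N≤m M⊔N≤n → begin-strict
    ∣ (s m ℚ.+ t m) ℚ.- (s n ℚ.+ t n) ∣
      ≡⟨ cong ∣_∣ (regroup (s m) (t m) (s n) (t n)) ⟩
    ∣ (s m ℚ.- s n) ℚ.+ (t m ℚ.- t n) ∣
      ≤⟨ ℚ.∣p+q∣≤∣p∣+∣q∣ (s m ℚ.- s n) (t m ℚ.- t n) ⟩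
    ∣ s m ℚ.- s n ∣ ℚ.+ ∣ t m ℚ.- t n ∣
      <⟨ ℚ.+-mono-< (p m n (ℕ.m⊔n≤o⇒m≤o M N M⊔N≤m) (ℕ.m⊔n≤o⇒m≤o M N M⊔N≤n))
                    (q m n (ℕ.m⊔n≤o⇒n≤o M N M⊔N≤m) (ℕ.m⊔n≤o⇒n≤o M N M⊔N≤n)) ⟩
    ε ℚ.* ½ ℚ.+ ε ℚ.* ½
      ≡⟨ half+half ε ⟩
    ε ∎
  where
  open ℚ.≤-Reasoning
  open ℚ.+-*-Solver
  s = seq x
  t = seq y
  regroup : ∀ a b c d → (a ℚ.+ b) ℚ.- (c ℚ.+ d) ≡ (a ℚ.- c) ℚ.+ (b ℚ.- d)
  regroup = solve 4 (λ a b c d → (a :+ b) :- (c :+ d) := (a :- c) :+ (b :- d)) refl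

_*_ : ℝ → ℝ → ℝ
seq (x * y) n = seq x n ℚ.* seq y n
cauchy (x * y) ε 0<ε =
  let K , B , 0<B , x≤B = bounded (seq x) (cauchy x)
      L , C , 0<C , y≤C = bounded (seq y) (cauchy y)
      δ , 0<δ , [B+C]δ≡ε = divide {B ℚ.+ C} (ℚ.+-mono-< 0<B 0<C) 0<ε
      M , p = cauchy x δ 0<δ
      N , q = cauchy y δ 0<δ
  in (K ⊔ L) ⊔ (M ⊔ N) , λ m n ≤m ≤n →
    let KL≤m = ℕ.m⊔n≤o⇒m≤o (K ⊔ L) (M ⊔ N) ≤m
        KL≤n = ℕ.m⊔n≤o⇒m≤o (K ⊔ L) (M ⊔ N) ≤n
        MN≤m = ℕ.m⊔n≤o⇒n≤o (K ⊔ L) (M ⊔ N) ≤m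
        MN≤n = ℕ.m⊔n≤o⇒n≤o (K ⊔ L) (M ⊔ N) ≤n
    in product-close (seq x m) (seq y m) (seq x n) (seq y n)
         {B} {C} {δ} 0<B 0<C [B+C]δ≡ε
         (x≤B m (ℕ.m⊔n≤o⇒m≤o K L KL≤m))
         (y≤C n (ℕ.m⊔n≤o⇒n≤o K L KL≤n))
         (p m n (ℕ.m⊔n≤o⇒m≤o M N MN≤m) (ℕ.m⊔n≤o⇒m≤o M N MN≤n))
         (q m n (ℕ.m⊔n≤o⇒n≤o M N MN≤m) (ℕ.m⊔n≤o⇒n≤o M N MN≤n))

+-0-rawMonoid : RawMonoid 0ℓ 0ℓ
+-0-rawMonoid = record { _≈_ = _≈_ ; _∙_ = _+_ ; ε = 0ℝ }

open RawMonoidDefinitions +-0-rawMonoid public using (sum)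

record BiquadraticForm (m n : ℕ) : Set where
  field
    coeff : Fin m → Fin n → Fin m → Fin n → ℝ
    sym₁  : ∀ i j k l → coeff i j k l ≈ coeff k j i l
    sym₂  : ∀ i j k l → coeff i j k l ≈ coeff k l i j

  eval : Vector ℝ m → Vector ℝ n → ℝ
  eval x y = sum λ i → sum λ k → sum λ j → sum λ l →
    coeff i j k l * x i * x k * y j * y l

BilinearForm : ℕ → ℕ → Set
BilinearForm m n = Fin m → Fin n → ℝ

evalBilinear : ∀ {m n} → BilinearForm m n → Vector ℝ m → Vector ℝ n → ℝ
evalBilinear b x y = sum λ i → sum λ j → b i j * x i * y j

-- Real polynomials are identified with the functions they define.

IsSumOfSquares : ∀ {m n} → BiquadraticForm m n → Pred ℕ 0ℓ
IsSumOfSquares {m} {n} P r =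
  Σ[ f ∈ Vector (BilinearForm m n) r ]
    ∀ x y → BiquadraticForm.eval P x y
              ≈ sum λ p → evalBilinear (f p) x y * evalBilinear (f p) x y

HasSOSRank : ∀ {m n} → BiquadraticForm m n → Pred ℕ 0ℓ
HasSOSRank P = IsMinimum (IsSumOfSquares P)

-- BSR(m,n) is the maximum of this set.

SOSRanks : ℕ → ℕ → Pred ℕ 0ℓ
SOSRanks m n r = Σ[ P ∈ BiquadraticForm m n ] HasSOSRank P r

Cell : ℕ → ℕ → Set
Cell m n = Fin m × Fin n

module _ {m n : ℕ} where

  row : Cell m n → Fin m
  row = proj₁

  col : Cell m n → Fin n
  col = proj₂

  C₄-Free : List (Cell m n) → Set
  C₄-Free E = ∀ {i k j l} → i ≢ k → j ≢ l →
    ¬ ((i , j) ∈ E × (i , l) ∈ E × (k , j) ∈ E × (k , l) ∈ E)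

IsZarankiewicz : ℕ → ℕ → Pred ℕ 0ℓ
IsZarankiewicz m n = IsMaximum λ k →
  Σ[ E ∈ List (Cell m n) ] Unique E × C₄-Free E × length E ≡ k

-- An unordered pair of distinct cells is represented by listing its
-- members in strictly increasing lexicographic order.  The irrelevant
-- field makes _≡_ equality of pairs.

record TwoEdge (m n : ℕ) : Set where
  constructor mk2
  field
    half₁ half₂ : Cell m n
    .ordered    : ×-Lex _≡_ Fin._<_ Fin._<_ half₁ half₂

  halves : List (Cell m n)
  halves = half₁ ∷ half₂ ∷ []

  Nondegenerate : Set
  Nondegenerate = row half₁ ≢ row half₂ × col half₁ ≢ col half₂

  oppositeCells : List (Cell m n)
  oppositeCells = (row half₁ , col half₂) ∷ (row half₂ , col half₁) ∷ []

open TwoEdge public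

data Edge (m n : ℕ) : Set where
  one : Cell m n → Edge m n
  two : TwoEdge m n → Edge m n

module _ {m n : ℕ} where

  -- When e is nondegenerate its opposite cells, in this order, are
  -- increasing, so no second disjunct for the swapped order is needed.

  Complementary : TwoEdge m n → TwoEdge m n → Set
  Complementary e f =
    Nondegenerate e × Nondegenerate f × halves f ≡ oppositeCells e

  cells : Edge m n → List (Cell m n)
  cells (one c) = c ∷ []
  cells (two e) = halves e

  rows : Edge m n → List (Fin m)
  rows e = map row (cells e)

  cols : Edge m n → List (Fin n)
  cols e = map col (cells e)

  VertexDisjoint : Edge m n → Edge m n → Set
  VertexDisjoint e f = Disjoint (rows e) (rows f) × Disjoint (cols e) (cols f)

  OppositeCell : Edge m n → Edge m n → Cell m n → Set
  OppositeCell e f c =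
    (row c ∈ rows e × col c ∈ cols f) ⊎ (row c ∈ rows f × col c ∈ cols e)

record AugmentedGraph (m n : ℕ) : Set where
  field
    E₁        : List (Cell m n)
    E₁-unique : Unique E₁
    E₂        : List (TwoEdge m n)
    E₂-unique : Unique E₂

  edges : List (Edge m n)
  edges = map one E₁ ++ map two E₂

  Occupied : Cell m n → Set
  Occupied c = c ∈ E₁ ⊎ Any (λ e → c ∈ halves e) E₂

  DVertex : TwoEdge m n → Set
  DVertex e = e ∈ E₂ × Nondegenerate e

  infix 4 _⟶_
  _⟶_ : TwoEdge m n → TwoEdge m n → Set
  e ⟶ e′ = DVertex e × DVertex e′ × e ≢ e′
         × All Occupied (oppositeCells e)
         × Any (_∈ halves e′) (oppositeCells e)

  -- v → v₁ → ⋯ → vₖ → v, where vs = v₁ ∷ ⋯ ∷ vₖ ∷ [].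

  DirectedCycle : TwoEdge m n → List (TwoEdge m n) → Set
  DirectedCycle v vs = Unique (v ∷ vs) × Linked _⟶_ (v ∷ vs ∷ʳ v)

  S : Set
  S = (∀ {e c} → e ∈ E₂ → c ∈ halves e → c ∉ E₁)
    × (∀ {e f} → e ∈ E₂ → f ∈ E₂ → e ≢ f → Disjoint (halves e) (halves f))

  W1 : Set
  W1 = C₄-Free E₁

  W2 : Set
  W2 = ∀ {v vs} → DirectedCycle v vs →
    ∃[ w ] vs ≡ w ∷ [] × Complementary v w

  W2′ : Set
  W2′ = ∀ {e} → e ∈ E₂ → Nondegenerate e → ¬ All (_∈ E₁) (oppositeCells e)

  -- VertexDisjoint and OppositeCell are symmetric in the two edges, so
  -- the 2-edge of the pair may be listed first.

  W3 : Set
  W3 = ∀ {e f} → e ∈ E₂ → f ∈ edges → VertexDisjoint (two e) f →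
    ∃[ c ] OppositeCell (two e) f c × ¬ Occupied c

-- z_wL(m,n) is the maximum of this set.

zwLSizes : ℕ → ℕ → Pred ℕ 0ℓ
zwLSizes m n k =
  Σ[ G ∈ AugmentedGraph m n ] let open AugmentedGraph G in
    S × W1 × W2 × W2′ × W3
    × IsZarankiewicz m n (length E₁)
    × length E₁ ℕ.+ length E₂ ≡ k

{-# OPTIONS --safe #-}

-- The graph has rows {1,2}, {1,3}, {2,3}, {1}, {2} of 1-edges and two
-- row-degenerate 2-edges filling rows 4 and 5, so that 𝒟 has no vertices.
-- z(5,3) ≤ 8 because in a C₄-free graph every cell that is not the first of its
-- row determines a pair of columns, and no pair of columns occurs twice.
--
-- A form of SOS rank 2m is Σᵢ xᵢ² ((tᵢ y₁ + y₂)² + y₃²) with distinct tᵢ.  If it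
-- equals Σₚ gₚ² with r terms, write Bᵢ(y) ∈ ℝʳ for the vector (gₚ(eᵢ, y))ₚ.
-- Comparing coefficients, ‖Bᵢ(y)‖² = (tᵢ y₁ + y₂)² + y₃², hence Bᵢ(1,-tᵢ,0) = 0,
-- and Bᵢ(y) ⟂ Bₖ(y) for i ≠ k.  For y = (1,-tₖ,1) the latter reads
-- (tᵢ - tₖ) Bᵢ(e₂)·Bₖ(e₃) = 0, so the 2m vectors Bᵢ(e₂), Bᵢ(e₃) are orthonormal
-- and 2m ≤ r.

module Submission where

open import Algebra.Bundles using (CommutativeRing)
import Algebra.Properties.Group as GroupProperties
import Algebra.Properties.Semiring.Mult as Multiples
import Algebra.Properties.Semiring.Sum as Sums
import Algebra.Solver.Ring.NaturalCoefficients.Default as SemiringSolver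
open import Data.Fin.Base as Fin using (Fin; zero; suc; toℕ; splitAt; join)
open import Data.Fin.Patterns using (0F; 1F; 2F; 3F; 4F)
import Data.Fin.Properties as Fin
open import Data.Nat.Base as ℕ using (ℕ; zero; suc; _⊔_)
import Data.Nat.Properties as ℕ
open import Data.Product.Base using (_×_; _,_; ∃-syntax; proj₁; proj₂)
open import Data.Product.Properties using (≡-dec)
open import Data.Rational.Base as ℚ using (ℚ; 0ℚ; 1ℚ; ½; ∣_∣; 1/_)
import Data.Rational.Properties as ℚ
import Data.Rational.Solver as ℚ
open import Data.Sum.Base using (_⊎_; inj₁; inj₂; [_,_]′)
import Data.Sum.Properties as Sum
import Data.Vec.Functional as Vector
open Vector using (Vector; _++_; tail)
open import Function.Base using (_∘_)
open import Level using (0ℓ)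
open import Relation.Binary.Definitions using (DecidableEquality; tri<; tri≈; tri>)
open import Relation.Binary.PropositionalEquality as ≡ using (_≡_; _≢_)
import Relation.Binary.Reasoning.Setoid as SetoidReasoning
open import Relation.Nullary using (¬_; Dec; yes; no; contradiction; ¬?)
open import Relation.Nullary.Decidable using (from-yes; map′; _×-dec_; _⊎-dec_; _→-dec_)

-- Sums of squares over a ring

module SumsOverRing (R : CommutativeRing 0ℓ 0ℓ) where
  open CommutativeRing R hiding (zero)
  open Sums semiring
  open SetoidReasoning setoid

  open SemiringSolver commutativeSemiring using (solve; _:=_; _:+_; _:*_; con)

  δ : ∀ {n} → Fin n → Vector Carrier n
  δ zero    zero    = 1#
  δ zero    (suc _) = 0#
  δ (suc _) zero    = 0#
  δ (suc i) (suc j) = δ i j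

  δ-diagonal : ∀ {n} (i : Fin n) → δ i i ≡ 1#
  δ-diagonal zero    = ≡.refl
  δ-diagonal (suc i) = δ-diagonal i

  δ-off-diagonal : ∀ {n} {i j : Fin n} → i ≢ j → δ i j ≡ 0#
  δ-off-diagonal {i = zero}  {zero}  i≢j = contradiction ≡.refl i≢j
  δ-off-diagonal {i = zero}  {suc j} i≢j = ≡.refl
  δ-off-diagonal {i = suc i} {zero}  i≢j = ≡.refl
  δ-off-diagonal {i = suc i} {suc j} i≢j = δ-off-diagonal (i≢j ∘ ≡.cong suc)

  sum-zero : ∀ {n} {t : Vector Carrier n} → (∀ i → t i ≈ 0#) → sum t ≈ 0#
  sum-zero {n} t≈0 = trans (sum-cong-≋ t≈0) (sum-replicate-zero n)

  sum-δ : ∀ {n} (i : Fin n) (t : Vector Carrier n) → sum (λ j → δ i j * t j) ≈ t i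
  sum-δ zero t = begin
    1# * t zero + sum (λ j → 0# * t (suc j))
      ≈⟨ +-cong (*-identityˡ _) (sum-zero λ j → zeroˡ (t (suc j))) ⟩
    t zero + 0#                               ≈⟨ +-identityʳ _ ⟩
    t zero                                    ∎
  sum-δ (suc i) t = begin
    0# * t zero + sum (λ j → δ i j * t (suc j))  ≈⟨ +-cong (zeroˡ _) (sum-δ i (t ∘ suc)) ⟩
    0# + t (suc i)                               ≈⟨ +-identityˡ _ ⟩
    t (suc i)                                    ∎

  sum-++ : ∀ {X : Set} {m n} (h : X → Carrier) (u : Vector X m) (v : Vector X n) →
    sum (h ∘ (u ++ v)) ≈ sum (h ∘ u) + sum (h ∘ v)
  sum-++ {m = zero}  h u v = sym (+-identityˡ _)
  sum-++ {m = suc m} h u v = begin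
    h (u zero) + sum (h ∘ (u ++ v) ∘ suc)
      ≡⟨ ≡.cong (h (u zero) +_) (sum-cong-≗ λ p → ≡.cong h (Sum.[,]-map (splitAt m p))) ⟩
    h (u zero) + sum (h ∘ ((u ∘ suc) ++ v))
      ≈⟨ +-congˡ (sum-++ h (u ∘ suc) v) ⟩
    h (u zero) + (sum (h ∘ u ∘ suc) + sum (h ∘ v))
      ≈⟨ +-assoc _ _ _ ⟨
    h (u zero) + sum (h ∘ u ∘ suc) + sum (h ∘ v) ∎

  sum-*-sum : ∀ {m n} (s : Vector Carrier m) (t : Vector Carrier n) →
    sum s * sum t ≈ sum (λ i → sum λ k → s i * t k)
  sum-*-sum s t = trans (*-distribʳ-sum (sum t) s) (sum-cong-≋ λ i → *-distribˡ-sum (s i) t)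

  infix 8 _∙_
  _∙_ : ∀ {r} → Vector Carrier r → Vector Carrier r → Carrier
  u ∙ v = sum λ p → u p * v p

  ∙-cong : ∀ {r} {u u′ v v′ : Vector Carrier r} →
    (∀ p → u p ≈ u′ p) → (∀ p → v p ≈ v′ p) → u ∙ v ≈ u′ ∙ v′
  ∙-cong u≈u′ v≈v′ = sum-cong-≋ λ p → *-cong (u≈u′ p) (v≈v′ p)

  ∙-comm : ∀ {r} (u v : Vector Carrier r) → u ∙ v ≈ v ∙ u
  ∙-comm u v = sum-cong-≋ λ p → *-comm (u p) (v p)

  ∙-linearˡ : ∀ {r} x (u v w : Vector Carrier r) →
    (λ p → u p + x * v p) ∙ w ≈ u ∙ w + x * (v ∙ w)
  ∙-linearˡ x u v w = begin
    sum (λ p → (u p + x * v p) * w p)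
      ≈⟨ sum-cong-≋ (λ p → expand x (u p) (v p) (w p)) ⟩
    sum (λ p → u p * w p + x * (v p * w p))
      ≈⟨ ∑-distrib-+ (λ p → u p * w p) (λ p → x * (v p * w p)) ⟩
    u ∙ w + sum (λ p → x * (v p * w p))
      ≈⟨ +-congˡ (*-distribˡ-sum x (λ p → v p * w p)) ⟨
    u ∙ w + x * (v ∙ w)                               ∎
    where
    expand : ∀ x a b c → (a + x * b) * c ≈ a * c + x * (b * c)
    expand = solve 4 (λ x a b c → (a :+ x :* b) :* c := (a :* c :+ x :* (b :* c))) refl

  -- The scalar serves two purposes: x = -1 gives the Bessel defect, x = 1 gives polarisation.
  norm-+ : ∀ {r} x (u v : Vector Carrier r) →
    (λ p → u p + x * v p) ∙ (λ p → u p + x * v p) ≈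
      u ∙ u + (x * (u ∙ v) + x * (u ∙ v)) + x * x * (v ∙ v)
  norm-+ x u v = begin
    w ∙ w                                               ≈⟨ ∙-linearˡ x u v w ⟩
    u ∙ w + x * (v ∙ w)                                 ≈⟨ +-cong (expand u) (*-congˡ (expand v)) ⟩
    u ∙ u + x * (u ∙ v) + x * (v ∙ u + x * (v ∙ v))
      ≈⟨ +-congˡ (*-congˡ (+-congʳ (∙-comm v u))) ⟩
    u ∙ u + x * (u ∙ v) + x * (u ∙ v + x * (v ∙ v))     ≈⟨ regroup x (u ∙ u) (u ∙ v) (v ∙ v) ⟩
    u ∙ u + (x * (u ∙ v) + x * (u ∙ v)) + x * x * (v ∙ v) ∎
    where
    w = λ p → u p + x * v p
    expand : ∀ z → z ∙ w ≈ z ∙ u + x * (z ∙ v)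
    expand z = begin
      z ∙ w                ≈⟨ ∙-comm z w ⟩
      w ∙ z                ≈⟨ ∙-linearˡ x u v z ⟩
      u ∙ z + x * (v ∙ z)  ≈⟨ +-cong (∙-comm u z) (*-congˡ (∙-comm v z)) ⟩
      z ∙ u + x * (z ∙ v)  ∎
    regroup : ∀ x a b c → a + x * b + x * (b + x * c) ≈ a + (x * b + x * b) + x * x * c
    regroup = solve 4 (λ x a b c →
      (a :+ x :* b :+ x :* (b :+ x :* c)) := (a :+ (x :* b :+ x :* b) :+ x :* x :* c)) refl

  evalBilinear : ∀ {m n} → (Fin m → Fin n → Carrier) → Vector Carrier m → Vector Carrier n → Carrier
  evalBilinear b x y = sum λ i → sum λ j → b i j * x i * y j

  square-evalBilinear : ∀ {m n} (b : Fin m → Fin n → Carrier) x y →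
    evalBilinear b x y * evalBilinear b x y ≈
      sum λ i → sum λ k → sum λ j → sum λ l → b i j * b k l * x i * x k * y j * y l
  square-evalBilinear b x y =
    trans (sum-*-sum (λ i → sum (λ j → b i j * x i * y j)) (λ k → sum (λ l → b k l * x k * y l)))
      (sum-cong-≋ λ i → sum-cong-≋ λ k →
        trans (sum-*-sum (λ j → b i j * x i * y j) (λ l → b k l * x k * y l))
          (sum-cong-≋ λ j → sum-cong-≋ λ l →
            solve 6 (λ b b′ x x′ y y′ →
              b :* x :* y :* (b′ :* x′ :* y′) := b :* b′ :* x :* x′ :* y :* y′) refl
              (b i j) (b k l) (x i) (x k) (y j) (y l)))

  -- Each square expands into a sum over i, k, j, l; moving the sum over p past these four indices
  -- collects the Gram matrix of the forms as coefficients.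
  evalGram : ∀ {m n r} (f : Vector (Fin m → Fin n → Carrier) r) x y →
    (sum λ i → sum λ k → sum λ j → sum λ l →
      (sum λ p → f p i j * f p k l) * x i * x k * y j * y l) ≈
    sum λ p → evalBilinear (f p) x y * evalBilinear (f p) x y
  evalGram f x y = sym (begin
    (sum λ p → evalBilinear (f p) x y * evalBilinear (f p) x y)
      ≈⟨ sum-cong-≋ (λ p → square-evalBilinear (f p) x y) ⟩
    (sum λ p → sum λ i → sum λ k → sum λ j → sum λ l → T i k j l p)
      ≈⟨ ∑-comm (λ p i → sum λ k → sum λ j → sum λ l → T i k j l p) ⟩
    (sum λ i → sum λ p → sum λ k → sum λ j → sum λ l → T i k j l p)
      ≈⟨ (sum-cong-≋ λ i → ∑-comm (λ p k → sum λ j → sum λ l → T i k j l p)) ⟩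
    (sum λ i → sum λ k → sum λ p → sum λ j → sum λ l → T i k j l p)
      ≈⟨ (sum-cong-≋ λ i → sum-cong-≋ λ k → ∑-comm (λ p j → sum λ l → T i k j l p)) ⟩
    (sum λ i → sum λ k → sum λ j → sum λ p → sum λ l → T i k j l p)
      ≈⟨ (sum-cong-≋ λ i → sum-cong-≋ λ k → sum-cong-≋ λ j → ∑-comm (λ p l → T i k j l p)) ⟩
    (sum λ i → sum λ k → sum λ j → sum λ l → sum λ p → T i k j l p)
      ≈⟨ (sum-cong-≋ λ i → sum-cong-≋ λ k → sum-cong-≋ λ j → sum-cong-≋ λ l → sym (factor i k j l)) ⟩
    (sum λ i → sum λ k → sum λ j → sum λ l →
      (sum λ p → f p i j * f p k l) * x i * x k * y j * y l) ∎)
    where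
    T = λ i k j l p → f p i j * f p k l * x i * x k * y j * y l
    factor : ∀ i k j l →
      (sum λ p → f p i j * f p k l) * x i * x k * y j * y l ≈ sum (T i k j l)
    factor i k j l = begin
      s * x i * x k * y j * y l
        ≈⟨ solve 5 (λ s x x′ y y′ → s :* x :* x′ :* y :* y′ := s :* (x :* x′ :* y :* y′)) refl
             s (x i) (x k) (y j) (y l) ⟩
      s * (x i * x k * y j * y l)
        ≈⟨ *-distribʳ-sum _ (λ p → f p i j * f p k l) ⟩
      (sum λ p → f p i j * f p k l * (x i * x k * y j * y l))
        ≈⟨ (sum-cong-≋ λ p →
             solve 5 (λ s x x′ y y′ → s :* (x :* x′ :* y :* y′) := s :* x :* x′ :* y :* y′) refl
               (f p i j * f p k l) (x i) (x k) (y j) (y l)) ⟩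
      sum (T i k j l) ∎
      where s = sum λ p → f p i j * f p k l

record IsNonNegativity (R : CommutativeRing 0ℓ 0ℓ)
  (NonNegative : CommutativeRing.Carrier R → Set) : Set where
  open CommutativeRing R hiding (zero)
  field
    0-nonNegative      : NonNegative 0#
    1-nonNegative      : NonNegative 1#
    +-nonNegative      : ∀ {x y} → NonNegative x → NonNegative y → NonNegative (x + y)
    square-nonNegative : ∀ x → NonNegative (x * x)
    +-≈0               : ∀ {x y} → NonNegative x → NonNegative y → x + y ≈ 0# → x ≈ 0#
    square-≈0          : ∀ {x} → x * x ≈ 0# → x ≈ 0#
    1≉0                : ¬ 1# ≈ 0#

module FormallyReal (R : CommutativeRing 0ℓ 0ℓ)
  (NonNegative : CommutativeRing.Carrier R → Set)
  (isNonNegativity : IsNonNegativity R NonNegative)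
  where
  open CommutativeRing R hiding (zero)
  open IsNonNegativity isNonNegativity
  open Sums semiring
  open Multiples semiring using (×-homo-+; ×-assoc-*; ×-congʳ) renaming (_×_ to _·_)
  open GroupProperties +-group using (∙-cancelʳ)
  open SumsOverRing R
  open Vector using ([]; _∷_)
  open SetoidReasoning setoid
  open SemiringSolver commutativeSemiring using (solve; _:=_; _:+_; _:*_; con)

  -- Orthonormal families over a formally real ring

  sum-nonNegative : ∀ {n} {t : Vector Carrier n} → (∀ i → NonNegative (t i)) → NonNegative (sum t)
  sum-nonNegative {zero}  t≥0 = 0-nonNegative
  sum-nonNegative {suc n} t≥0 = +-nonNegative (t≥0 zero) (sum-nonNegative (t≥0 ∘ suc))

  ·-nonNegative : ∀ n {x} → NonNegative x → NonNegative (n · x)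
  ·-nonNegative zero    x≥0 = 0-nonNegative
  ·-nonNegative (suc n) x≥0 = +-nonNegative x≥0 (·-nonNegative n x≥0)

  -- Multiplying by x turns the hypothesis into a vanishing sum of two squares, which replaces
  -- division by 2.
  x+x≈0⇒x≈0 : ∀ {x} → x + x ≈ 0# → x ≈ 0#
  x+x≈0⇒x≈0 {x} 2x≈0 = square-≈0 (+-≈0 (square-nonNegative x) (square-nonNegative x) (begin
    x * x + x * x  ≈⟨ distribˡ x x x ⟨
    x * (x + x)    ≈⟨ *-congˡ 2x≈0 ⟩
    x * 0#         ≈⟨ zeroʳ x ⟩
    0#             ∎))

  norm-≈0 : ∀ {r} {u : Vector Carrier r} → u ∙ u ≈ 0# → ∀ p → u p ≈ 0#
  norm-≈0 {suc r} {u} uu≈0 zero =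
    square-≈0 (+-≈0 (square-nonNegative (u zero)) (sum-nonNegative λ p → square-nonNegative (u (suc p))) uu≈0)
  norm-≈0 {suc r} {u} uu≈0 (suc p) =
    norm-≈0 {u = u ∘ suc} (+-≈0 (sum-nonNegative λ p → square-nonNegative (u (suc p))) (square-nonNegative (u zero))
      (trans (+-comm _ _) uu≈0)) p

  -- Σ_q (δ p q − Σ_a V a p V a q)² = 1 − Σ_a (V a p)², the squared
  -- distance of a unit vector to the span of the family.

  bessel : ∀ {n r} (V : Fin n → Vector Carrier r) → (∀ a b → V a ∙ V b ≈ δ a b) → ∀ p →
    ∃[ d ] NonNegative d × d + sum (λ a → V a p * V a p) ≈ 1#
  bessel {r = r} V orthonormal p = v ∙ v , sum-nonNegative (λ q → square-nonNegative (v q))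
    , (begin
    v ∙ v + s                                           ≈⟨ +-congʳ (norm-+ n e w) ⟩
    e ∙ e + (n * (e ∙ w) + n * (e ∙ w)) + n * n * (w ∙ w) + s
      ≈⟨ +-congʳ (+-cong (+-cong e∙e (+-cong (*-congˡ e∙w) (*-congˡ e∙w))) (*-congˡ w∙w)) ⟩
    1# + (n * s + n * s) + n * n * s + s
      -- With `n` treated as an indeterminate, everything beyond the leading 1 has the factor 1 + n,
      -- which vanishes because `n` is -1.
      ≈⟨ solve 3 (λ i n s → i :+ (n :* s :+ n :* s) :+ n :* n :* s :+ s :=
           i :+ (con 1 :+ n) :* (n :* s :+ s)) refl 1# n s ⟩
    1# + (1# + n) * (n * s + s)  ≈⟨ +-congˡ (*-congʳ (-‿inverseʳ 1#)) ⟩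
    1# + 0# * (n * s + s)             ≈⟨ +-congˡ (zeroˡ (n * s + s)) ⟩
    1# + 0#                           ≈⟨ +-identityʳ 1# ⟩
    1#                                ∎)
    where
    n = - 1#
    s = sum λ a → V a p * V a p
    e = δ p
    w : Vector Carrier r
    w q = sum λ a → V a p * V a q
    v : Vector Carrier r
    v q = e q + n * w q

    e∙e : e ∙ e ≈ 1#
    e∙e = trans (sum-δ p e) (reflexive (δ-diagonal p))

    e∙w : e ∙ w ≈ s
    e∙w = sum-δ p w

    -- `w` is the projection of the unit vector `δ p` onto the span of the family, so both have the
    -- same inner product with each member.
    V∙w : ∀ b → w ∙ V b ≈ V b p
    V∙w b = begin
      (sum λ q → w q * V b q)
        ≈⟨ (sum-cong-≋ λ q → *-distribʳ-sum (V b q) (λ a → V a p * V a q)) ⟩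
      (sum λ q → sum λ a → V a p * V a q * V b q)      ≈⟨ ∑-comm (λ q a → V a p * V a q * V b q) ⟩
      (sum λ a → sum λ q → V a p * V a q * V b q)
        ≈⟨ (sum-cong-≋ λ a → sum-cong-≋ λ q → *-assoc (V a p) (V a q) (V b q)) ⟩
      (sum λ a → sum λ q → V a p * (V a q * V b q))
        ≈⟨ (sum-cong-≋ λ a → *-distribˡ-sum (V a p) (λ q → V a q * V b q)) ⟨
      (sum λ a → V a p * (V a ∙ V b))
        ≈⟨ (sum-cong-≋ λ a → trans
             (*-congˡ (trans (∙-comm (V a) (V b)) (orthonormal b a))) (*-comm (V a p) (δ b a))) ⟩
      (sum λ a → δ b a * V a p)                        ≈⟨ sum-δ b (λ a → V a p) ⟩
      V b p                                            ∎

    w∙w : w ∙ w ≈ s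
    w∙w = begin
      (sum λ q → w q * w q)
        ≈⟨ (sum-cong-≋ λ q → *-distribˡ-sum (w q) (λ a → V a p * V a q)) ⟩
      (sum λ q → sum λ a → w q * (V a p * V a q))  ≈⟨ ∑-comm (λ q a → w q * (V a p * V a q)) ⟩
      (sum λ a → sum λ q → w q * (V a p * V a q))
        ≈⟨ (sum-cong-≋ λ a → sum-cong-≋ λ q →
             solve 3 (λ x y z → x :* (y :* z) := y :* (x :* z)) refl (w q) (V a p) (V a q)) ⟩
      (sum λ a → sum λ q → V a p * (w q * V a q))
        ≈⟨ (sum-cong-≋ λ a → *-distribˡ-sum (V a p) (λ q → w q * V a q)) ⟨
      (sum λ a → V a p * (w ∙ V a))                ≈⟨ (sum-cong-≋ λ a → *-congˡ (V∙w a)) ⟩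
      s                                            ∎

  -- Adding the identities of `bessel` over all r coordinates gives D + n = r, where D is a sum of
  -- non-negative defects and n is the sum of the squared norms. This trace count takes the place of
  -- a dimension argument.
  orthonormal⇒≤ : ∀ {n r} (V : Fin n → Vector Carrier r) → (∀ a b → V a ∙ V b ≈ δ a b) → n ℕ.≤ r
  orthonormal⇒≤ {n} {r} V orthonormal with n ℕ.≤? r
  ... | yes n≤r = n≤r
  ... | no  n≰r = contradiction 1≈0 1≉0
    where
    defect = λ p → proj₁ (bessel V orthonormal p)
    total : sum defect + n · 1# ≈ r · 1#
    total = begin
      sum defect + n · 1#                                 ≈⟨ +-congˡ (sum-replicate n) ⟨
      sum defect + sum (λ (a : Fin n) → 1#)
        ≈⟨ +-congˡ (sum-cong-≋ λ a → trans (orthonormal a a) (reflexive (δ-diagonal a))) ⟨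
      sum defect + sum (λ a → V a ∙ V a)
        ≈⟨ +-congˡ (∑-comm (λ a p → V a p * V a p)) ⟩
      sum defect + sum (λ p → sum λ a → V a p * V a p)
        ≈⟨ ∑-distrib-+ defect (λ p → sum λ a → V a p * V a p) ⟨
      sum (λ p → defect p + sum λ a → V a p * V a p)
        ≈⟨ (sum-cong-≋ λ p → proj₂ (proj₂ (bessel V orthonormal p))) ⟩
      sum (λ (p : Fin r) → 1#)                            ≈⟨ sum-replicate r ⟩
      r · 1#                                              ∎
    1≈0 : 1# ≈ 0#
    1≈0 with ℕ.m≤n⇒∃[o]m+o≡n (ℕ.≰⇒> n≰r)
    -- Here n = 1 + r + k. Cancelling r from D + n = r leaves 1 + (k + D) = 0, a vanishing sum of
    -- non-negative terms, so its first term 1 vanishes.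
    ... | k , ≡.refl = +-≈0 1-nonNegative
      (+-nonNegative (·-nonNegative k 1-nonNegative) (sum-nonNegative λ p → proj₁ (proj₂ (bessel V orthonormal p))))
      (∙-cancelʳ (r · 1#) _ _ (begin
        1# + (k · 1# + sum defect) + r · 1#
          ≈⟨ solve 4 (λ i k d r → i :+ (k :+ d) :+ r := d :+ (i :+ (r :+ k))) refl
               1# (k · 1#) (sum defect) (r · 1#) ⟩
        sum defect + (1# + (r · 1# + k · 1#))    ≈⟨ +-congˡ (+-congˡ (×-homo-+ 1# r k)) ⟨
        sum defect + (suc (r ℕ.+ k) · 1#)        ≈⟨ total ⟩
        r · 1#                                   ≈⟨ +-identityˡ _ ⟨
        0# + r · 1#                              ∎))

  -- The distinct slopes tᵢ = 0, 1, 2, ...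

  position : ∀ {m} → Fin m → Carrier
  position i = toℕ i · 1#

  -- Multiplying by z once more gives z² + n z² = 0, again a vanishing sum of non-negative terms.
  suc·1-cancel : ∀ n z → (suc n · 1#) * z ≈ 0# → z ≈ 0#
  suc·1-cancel n z nz≈0 = square-≈0 (+-≈0 (square-nonNegative z) (·-nonNegative n (square-nonNegative z)) (begin
    z * z + n · (z * z)
      ≈⟨ +-cong (*-identityˡ (z * z)) (trans (×-assoc-* n 1# (z * z)) (×-congʳ n (*-identityˡ (z * z)))) ⟨
    1# * (z * z) + n · 1# * (z * z) ≈⟨ distribʳ (z * z) 1# (n · 1#) ⟨
    (suc n · 1#) * (z * z)       ≈⟨ *-assoc _ z z ⟨
    (suc n · 1#) * z * z         ≈⟨ *-congʳ nz≈0 ⟩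
    0# * z                       ≈⟨ zeroˡ z ⟩
    0#                           ∎))

  -- The difference of two distinct slopes is, up to sign, a positive multiple of 1, and such
  -- multiples can be cancelled by `suc·1-cancel`.
  position-separates : ∀ {m} {i k : Fin m} → i ≢ k → ∀ z →
    (position i + - position k) * z ≈ 0# → z ≈ 0#
  position-separates {i = i} {k} i≢k z dz≈0 with ℕ.<-cmp (toℕ i) (toℕ k)
  ... | tri≈ _ i≡k _ = contradiction (Fin.toℕ-injective i≡k) i≢k
  ... | tri> _ _ k<i with ℕ.m≤n⇒∃[o]m+o≡n k<i
  ...   | o , eq = suc·1-cancel o z (trans (*-congʳ (sym (begin
            position i + - position k
              ≡⟨ ≡.cong (λ n → n · 1# + - position k) (≡.trans (≡.sym eq) (≡.sym (ℕ.+-suc (toℕ k) o))) ⟩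
            (toℕ k ℕ.+ suc o) · 1# + - position k
              ≈⟨ +-congʳ (trans (×-homo-+ 1# (toℕ k) (suc o)) (+-comm _ _)) ⟩
            suc o · 1# + position k + - position k        ≈⟨ +-assoc _ _ _ ⟩
            suc o · 1# + (position k + - position k)      ≈⟨ +-congˡ (-‿inverseʳ (position k)) ⟩
            suc o · 1# + 0#                               ≈⟨ +-identityʳ _ ⟩
            suc o · 1#                                    ∎))) dz≈0)
  position-separates {i = i} {k} i≢k z dz≈0 | tri< i<k _ _ with ℕ.m≤n⇒∃[o]m+o≡n i<k
  -- The difference is now the negative of `suc o · 1#`. Adding the vanishing product to
  -- `(suc o · 1#) * z` raises tᵢ to tₖ, so that the total becomes (tₖ - tₖ) z.
  ...   | o , eq = suc·1-cancel o z (begin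
            (suc o · 1#) * z                                              ≈⟨ +-identityˡ _ ⟨
            0# + (suc o · 1#) * z                                         ≈⟨ +-congʳ dz≈0 ⟨
            (position i + - position k) * z + (suc o · 1#) * z
              ≈⟨ solve 4 (λ i k o z → (i :+ k) :* z :+ o :* z := (i :+ o :+ k) :* z) refl
                   (position i) (- position k) (suc o · 1#) z ⟩
            (position i + suc o · 1# + - position k) * z
              ≈⟨ *-congʳ (+-congʳ (×-homo-+ 1# (toℕ i) (suc o))) ⟨
            ((toℕ i ℕ.+ suc o) · 1# + - position k) * z
              ≡⟨ ≡.cong (λ n → (n · 1# + - position k) * z) (≡.trans (ℕ.+-suc (toℕ i) o) eq) ⟩
            (position k + - position k) * z
              ≈⟨ *-congʳ (-‿inverseʳ (position k)) ⟩
            0# * z                                                        ≈⟨ zeroˡ z ⟩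
            0#                                                            ∎)

  -- The extremal form as a sum of 2m squares

  evalBilinear-rows : ∀ {m n} (b : Fin m → Fin n → Carrier) x y →
    evalBilinear b x y ≈ sum λ i → x i * (b i ∙ y)
  evalBilinear-rows b x y = sum-cong-≋ λ i → trans
    (sum-cong-≋ λ j → solve 3 (λ b x y → b :* x :* y := x :* (b :* y)) refl (b i j) (x i) (y j))
    (sym (*-distribˡ-sum (x i) (λ j → b i j * y j)))

  -- A linear form in x times a linear form in y. For such products the Gram coefficients are
  -- already symmetric under exchange of i and k, which fails for general bilinear forms.
  ProductForm : ℕ → ℕ → Set
  ProductForm m n = Vector Carrier m × Vector Carrier n

  bilinear : ∀ {m n} → ProductForm m n → Fin m → Fin n → Carrier
  bilinear (ξ , η) i j = ξ i * η j

  evalBilinear-unit : ∀ {m n} (i : Fin m) (η : Vector Carrier n) x y →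
    evalBilinear (bilinear (δ i , η)) x y ≈ x i * (η ∙ y)
  evalBilinear-unit i η x y = begin
    evalBilinear (bilinear (δ i , η)) x y
      ≈⟨ evalBilinear-rows (bilinear (δ i , η)) x y ⟩
    (sum λ k → x k * (sum λ j → δ i k * η j * y j))
      ≈⟨ (sum-cong-≋ λ k → *-congˡ (trans
           (sum-cong-≋ λ j → *-assoc (δ i k) (η j) (y j))
           (sym (*-distribˡ-sum (δ i k) (λ j → η j * y j))))) ⟩
    (sum λ k → x k * (δ i k * (η ∙ y)))
      ≈⟨ (sum-cong-≋ λ k → solve 3 (λ x d e → x :* (d :* e) := d :* (x :* e)) refl (x k) (δ i k) (η ∙ y)) ⟩
    (sum λ k → δ i k * (x k * (η ∙ y)))                ≈⟨ sum-δ i (λ k → x k * (η ∙ y)) ⟩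
    x i * (η ∙ y)                                      ∎

  -- Indices count from 0 here, so `e₁` and `e₂` are the vectors written e₂ and e₃ in the outline of
  -- the proof.
  e₁ e₂ e₁+e₂ : Vector Carrier 3
  e₁    = 0# ∷ 1# ∷ 0# ∷ []
  e₂    = 0# ∷ 0# ∷ 1# ∷ []
  e₁+e₂ = 0# ∷ 1# ∷ 1# ∷ []

  slanted : ∀ {m} → Fin m → Vector Carrier 3
  slanted i = position i ∷ 1# ∷ 0# ∷ []

  extremal : ∀ m → Vector (ProductForm m 3) (m ℕ.+ m)
  extremal m = (λ i → δ i , slanted i) ++ (λ i → δ i , e₂)

  rowForm : ∀ {m} → Fin m → Vector Carrier 3 → Carrier
  rowForm i y = (position i * y 0F + y 1F) * (position i * y 0F + y 1F) + y 2F * y 2F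

  sum-extremal : ∀ m x y →
    (sum λ p → evalBilinear (bilinear (extremal m p)) x y * evalBilinear (bilinear (extremal m p)) x y)
      ≈ sum λ i → x i * x i * rowForm i y
  sum-extremal m x y = begin
    (sum λ p → square (extremal m p))       ≈⟨ sum-++ square u v ⟩
    (sum λ i → square (u i)) + (sum λ i → square (v i))   ≈⟨ ∑-distrib-+ (square ∘ u) (square ∘ v) ⟨
    (sum λ i → square (u i) + square (v i))
      ≈⟨ (sum-cong-≋ λ i → trans
           (+-cong (*-cong (evalBilinear-unit i (slanted i) x y) (evalBilinear-unit i (slanted i) x y))
                   (*-cong (evalBilinear-unit i e₂ x y) (evalBilinear-unit i e₂ x y)))
           (solve 5 (λ x t y₀ y₁ y₂ →
              let c = t :* y₀ :+ (con 1 :* y₁ :+ (con 0 :* y₂ :+ con 0))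
                  d = con 0 :* y₀ :+ (con 0 :* y₁ :+ (con 1 :* y₂ :+ con 0))
              in x :* c :* (x :* c) :+ x :* d :* (x :* d) :=
                 x :* x :* ((t :* y₀ :+ y₁) :* (t :* y₀ :+ y₁) :+ y₂ :* y₂)) refl
              (x i) (position i) (y 0F) (y 1F) (y 2F))) ⟩
    (sum λ i → x i * x i * rowForm i y)    ∎
    where
    square : ProductForm m 3 → Carrier
    square f = evalBilinear (bilinear f) x y * evalBilinear (bilinear f) x y
    u = λ i → δ i , slanted i
    v = λ i → δ i , e₂

  -- Lower bound on the number of squares

  module _ {m r : ℕ} (g : Vector (Fin m → Fin 3 → Carrier) r)
    (squares : ∀ x y → (sum λ p → evalBilinear (g p) x y * evalBilinear (g p) x y)
                 ≈ sum λ i → x i * x i * rowForm i y)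
    where

    -- The vector Bᵢ(y) of the outline.
    image : Fin m → Vector Carrier 3 → Vector Carrier r
    image i y p = g p i ∙ y

    -- Setting x to the unit vector `δ i` isolates row i on both sides of `squares`.
    image-norm : ∀ i y → image i y ∙ image i y ≈ rowForm i y
    image-norm i y = begin
      image i y ∙ image i y
        ≈⟨ (sum-cong-≋ λ p → *-cong (at-δ p) (at-δ p)) ⟨
      (sum λ p → evalBilinear (g p) (δ i) y * evalBilinear (g p) (δ i) y)
        ≈⟨ squares (δ i) y ⟩
      (sum λ k → δ i k * δ i k * rowForm k y)
        ≈⟨ (sum-cong-≋ λ k → *-assoc (δ i k) (δ i k) (rowForm k y)) ⟩
      (sum λ k → δ i k * (δ i k * rowForm k y))
        ≈⟨ sum-δ i (λ k → δ i k * rowForm k y) ⟩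
      δ i i * rowForm i y
        ≈⟨ *-congʳ (reflexive (δ-diagonal i)) ⟩
      1# * rowForm i y
        ≈⟨ *-identityˡ _ ⟩
      rowForm i y ∎
      where
      at-δ : ∀ p → evalBilinear (g p) (δ i) y ≈ image i y p
      at-δ p = trans (evalBilinear-rows (g p) (δ i) y) (sum-δ i (λ k → g p k ∙ y))

    -- Polarisation: when squared norms add, the cross term u·v + u·v vanishes. The factor `1#`
    -- matches the shape of `norm-+`.
    norm-additive⇒∙≈0 : ∀ {u v : Vector Carrier r} {x y} → u ∙ u ≈ x → v ∙ v ≈ y →
      (λ p → u p + 1# * v p) ∙ (λ p → u p + 1# * v p) ≈ x + y → u ∙ v ≈ 0#
    norm-additive⇒∙≈0 {u} {v} {x} {y} uu≈x vv≈y sum≈ = x+x≈0⇒x≈0 (∙-cancelʳ (x + y) _ _ (begin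
      u ∙ v + u ∙ v + (x + y)   ≈⟨ +-congˡ (+-cong uu≈x vv≈y) ⟨
      u ∙ v + u ∙ v + (u ∙ u + v ∙ v)
        ≈⟨ solve 3 (λ a b c → b :+ b :+ (a :+ c) := a :+ (con 1 :* b :+ con 1 :* b) :+ con 1 :* con 1 :* c) refl
             (u ∙ u) (u ∙ v) (v ∙ v) ⟩
      u ∙ u + (1# * (u ∙ v) + 1# * (u ∙ v)) + 1# * 1# * (v ∙ v)   ≈⟨ norm-+ 1# u v ⟨
      (λ p → u p + 1# * v p) ∙ (λ p → u p + 1# * v p)   ≈⟨ sum≈ ⟩
      x + y                     ≈⟨ +-identityˡ _ ⟨
      0# + (x + y)              ∎))

    -- Evaluating at x = `δ i` + `δ k` makes the squared norms add, because the form has no mixed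
    -- term in xᵢ xₖ.
    image-orthogonal : ∀ {i k} → i ≢ k → ∀ y → image i y ∙ image k y ≈ 0#
    image-orthogonal {i} {k} i≢k y = norm-additive⇒∙≈0 (image-norm i y) (image-norm k y) (begin
      (λ p → image i y p + 1# * image k y p) ∙ (λ p → image i y p + 1# * image k y p)
        ≈⟨ (sum-cong-≋ λ p → *-cong (at-δ+δ p) (at-δ+δ p)) ⟨
      (sum λ p → evalBilinear (g p) e y * evalBilinear (g p) e y)
        ≈⟨ squares e y ⟩
      (sum λ j → e j * e j * rowForm j y)
        ≈⟨ (sum-cong-≋ λ j → *-assoc (e j) (e j) (rowForm j y)) ⟩
      (sum λ j → e j * (e j * rowForm j y))
        ≈⟨ sum-δ+δ (λ j → e j * rowForm j y) ⟩
      e i * rowForm i y + e k * rowForm k y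
        ≈⟨ +-cong (*-congʳ (+-cong (reflexive (δ-diagonal i)) (reflexive (δ-off-diagonal (i≢k ∘ ≡.sym)))))
                  (*-congʳ (+-cong (reflexive (δ-off-diagonal i≢k)) (reflexive (δ-diagonal k)))) ⟩
      (1# + 0#) * rowForm i y + (0# + 1#) * rowForm k y
        ≈⟨ solve 2 (λ a b → (con 1 :+ con 0) :* a :+ (con 0 :+ con 1) :* b := a :+ b) refl
             (rowForm i y) (rowForm k y) ⟩
      rowForm i y + rowForm k y ∎)
      where
      e = λ j → δ i j + δ k j
      sum-δ+δ : ∀ t → (sum λ j → e j * t j) ≈ t i + t k
      sum-δ+δ t = begin
        (sum λ j → (δ i j + δ k j) * t j)
          ≈⟨ (sum-cong-≋ λ j → distribʳ (t j) (δ i j) (δ k j)) ⟩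
        (sum λ j → δ i j * t j + δ k j * t j)
          ≈⟨ ∑-distrib-+ (λ j → δ i j * t j) (λ j → δ k j * t j) ⟩
        (sum λ j → δ i j * t j) + (sum λ j → δ k j * t j) ≈⟨ +-cong (sum-δ i t) (sum-δ k t) ⟩
        t i + t k ∎
      at-δ+δ : ∀ p → evalBilinear (g p) e y ≈ image i y p + 1# * image k y p
      at-δ+δ p = begin
        evalBilinear (g p) e y            ≈⟨ evalBilinear-rows (g p) e y ⟩
        (sum λ j → e j * image j y p)     ≈⟨ sum-δ+δ (λ j → image j y p) ⟩
        image i y p + image k y p         ≈⟨ +-congˡ (*-identityˡ _) ⟨
        image i y p + 1# * image k y p    ∎

    a b c : Fin m → Vector Carrier r
    c i p = g p i 0F
    a i p = g p i 1F
    b i p = g p i 2F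

    image-e₁ : ∀ i p → image i e₁ p ≈ a i p
    image-e₁ i p = solve 3 (λ c a b →
      c :* con 0 :+ (a :* con 1 :+ (b :* con 0 :+ con 0)) := a) refl (c i p) (a i p) (b i p)

    image-e₂ : ∀ i p → image i e₂ p ≈ b i p
    image-e₂ i p = solve 3 (λ c a b →
      c :* con 0 :+ (a :* con 0 :+ (b :* con 1 :+ con 0)) := b) refl (c i p) (a i p) (b i p)

    image-e₁+e₂ : ∀ i p → image i e₁+e₂ p ≈ a i p + 1# * b i p
    image-e₁+e₂ i p = solve 3 (λ c a b →
      c :* con 0 :+ (a :* con 1 :+ (b :* con 1 :+ con 0)) := a :+ con 1 :* b) refl (c i p) (a i p) (b i p)

    a-unit : ∀ i → a i ∙ a i ≈ 1#
    a-unit i = trans (sym (∙-cong (image-e₁ i) (image-e₁ i))) (trans (image-norm i e₁)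
      (solve 1 (λ t → (t :* con 0 :+ con 1) :* (t :* con 0 :+ con 1) :+ con 0 :* con 0 := con 1)
        refl (position i)))

    b-unit : ∀ i → b i ∙ b i ≈ 1#
    b-unit i = trans (sym (∙-cong (image-e₂ i) (image-e₂ i))) (trans (image-norm i e₂)
      (solve 1 (λ t → (t :* con 0 :+ con 0) :* (t :* con 0 :+ con 0) :+ con 1 :* con 1 := con 1)
        refl (position i)))

    -- `rowForm i` takes the value 1 at `e₁` and at `e₂` and the value 1 + 1 at their sum, so
    -- polarisation applies.
    a-b-same-row : ∀ i → a i ∙ b i ≈ 0#
    a-b-same-row i = norm-additive⇒∙≈0 (a-unit i) (b-unit i)
      (trans (sym (∙-cong (image-e₁+e₂ i) (image-e₁+e₂ i))) (trans (image-norm i e₁+e₂)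
        (solve 1 (λ t → (t :* con 0 :+ con 1) :* (t :* con 0 :+ con 1) :+ con 1 :* con 1 := con 1 :+ con 1)
          refl (position i))))

    a-a : ∀ {i k} → i ≢ k → a i ∙ a k ≈ 0#
    a-a i≢k = trans (sym (∙-cong (image-e₁ _) (image-e₁ _))) (image-orthogonal i≢k e₁)

    b-b : ∀ {i k} → i ≢ k → b i ∙ b k ≈ 0#
    b-b i≢k = trans (sym (∙-cong (image-e₂ _) (image-e₂ _))) (image-orthogonal i≢k e₂)

    -- `rowForm i` vanishes at y = (1, -tᵢ, 0), so Bᵢ(y) has norm zero and each of its components is
    -- zero.
    kernel : ∀ i p → c i p + - position i * a i p ≈ 0#
    kernel i p = trans
      (solve 4 (λ c a b t → c :+ t :* a := c :* con 1 :+ (a :* t :+ (b :* con 0 :+ con 0))) refl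
        (c i p) (a i p) (b i p) (- position i))
      (norm-≈0 (trans (image-norm i (1# ∷ - position i ∷ 0# ∷ [])) (begin
        (position i * 1# + - position i) * (position i * 1# + - position i) + 0# * 0#
          ≈⟨ solve 2 (λ t s → (t :* con 1 :+ s) :* (t :* con 1 :+ s) :+ con 0 :* con 0 := (t :+ s) :* (t :+ s)) refl
               (position i) (- position i) ⟩
        (position i + - position i) * (position i + - position i)
          ≈⟨ *-congʳ (-‿inverseʳ (position i)) ⟩
        0# * (position i + - position i)
          ≈⟨ zeroˡ _ ⟩
        0# ∎)) p)

    a-b : ∀ {i k} → i ≢ k → a i ∙ b k ≈ 0#
    a-b {i} {k} i≢k = position-separates i≢k (a i ∙ b k) (begin
      (position i + s) * (a i ∙ b k)
        ≈⟨ +-identityˡ _ ⟨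
      0# + (position i + s) * (a i ∙ b k)
        ≈⟨ +-congʳ (b-b i≢k) ⟨
      b i ∙ b k + (position i + s) * (a i ∙ b k)
        ≈⟨ ∙-linearˡ (position i + s) (b i) (a i) (b k) ⟨
      (λ p → b i p + (position i + s) * a i p) ∙ b k
        ≈⟨ ∙-cong image-i image-k ⟨
      image i y ∙ image k y
        ≈⟨ image-orthogonal i≢k y ⟩
      0# ∎)
      where
      s = - position k
      -- The second entry -tₖ makes the slanted part of row k vanish, so Bₖ(y) reduces to `b k`,
      -- while row i keeps (tᵢ - tₖ) `a i` + `b i`.
      y = 1# ∷ s ∷ 1# ∷ []
      image-i : ∀ p → image i y p ≈ b i p + (position i + s) * a i p
      image-i p = begin
        image i y p
          ≈⟨ +-identityʳ _ ⟨
        image i y p + 0#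
          -- Inserting (tᵢ - tᵢ) `a i` = 0 allows `kernel` to absorb `c i`, with the multiple tᵢ of
          -- `a i` left over.
          ≈⟨ +-congˡ (trans (*-congʳ (-‿inverseʳ (position i))) (zeroˡ (a i p))) ⟨
        image i y p + (position i + - position i) * a i p
          ≈⟨ solve 6 (λ c a b s t n →
               c :* con 1 :+ (a :* s :+ (b :* con 1 :+ con 0)) :+ (t :+ n) :* a :=
               (b :+ (t :+ s) :* a) :+ (c :+ n :* a)) refl
               (c i p) (a i p) (b i p) s (position i) (- position i) ⟩
        b i p + (position i + s) * a i p + (c i p + - position i * a i p)
          ≈⟨ +-congˡ (kernel i p) ⟩
        b i p + (position i + s) * a i p + 0#
          ≈⟨ +-identityʳ _ ⟩
        b i p + (position i + s) * a i p ∎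
      image-k : ∀ p → image k y p ≈ b k p
      image-k p = begin
        image k y p
          ≈⟨ solve 4 (λ c a b s → c :* con 1 :+ (a :* s :+ (b :* con 1 :+ con 0)) := (c :+ s :* a) :+ b) refl
               (c k p) (a k p) (b k p) s ⟩
        c k p + s * a k p + b k p
          ≈⟨ +-congʳ (kernel k p) ⟩
        0# + b k p
          ≈⟨ +-identityˡ _ ⟩
        b k p ∎

    basis : Fin m ⊎ Fin m → Vector Carrier r
    basis = [ a , b ]′

    basis-unit : ∀ s → basis s ∙ basis s ≈ 1#
    basis-unit (inj₁ i) = a-unit i
    basis-unit (inj₂ i) = b-unit i

    basis-orthogonal : ∀ s s′ → s ≢ s′ → basis s ∙ basis s′ ≈ 0#
    basis-orthogonal (inj₁ i) (inj₁ k) s≢s′ = a-a (s≢s′ ∘ ≡.cong inj₁)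
    basis-orthogonal (inj₂ i) (inj₂ k) s≢s′ = b-b (s≢s′ ∘ ≡.cong inj₂)
    basis-orthogonal (inj₁ i) (inj₂ k) _ with i Fin.≟ k
    ... | yes ≡.refl = a-b-same-row i
    ... | no  i≢k    = a-b i≢k
    basis-orthogonal (inj₂ i) (inj₁ k) s≢s′ =
      trans (∙-comm (b i) (a k)) (basis-orthogonal (inj₁ k) (inj₂ i) λ ())

    2m≤r : m ℕ.+ m ℕ.≤ r
    2m≤r = orthonormal⇒≤ (basis ∘ splitAt m) orthonormal
      where
      splitAt-injective : ∀ {p q} → splitAt m {m} p ≡ splitAt m q → p ≡ q
      splitAt-injective {p} {q} eq = ≡.trans (≡.sym (Fin.join-splitAt m m p))
        (≡.trans (≡.cong (join m m) eq) (Fin.join-splitAt m m q))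
      orthonormal : ∀ p q → basis (splitAt m p) ∙ basis (splitAt m q) ≈ δ p q
      orthonormal p q with p Fin.≟ q
      ... | yes ≡.refl = trans (basis-unit (splitAt m p)) (reflexive (≡.sym (δ-diagonal p)))
      ... | no  p≢q    = trans (basis-orthogonal _ _ (p≢q ∘ splitAt-injective))
                               (reflexive (≡.sym (δ-off-diagonal p≢q)))

  -- Gram coefficients and minimality

  gramCoeff : ∀ {m n r} → Vector (ProductForm m n) r → Fin m → Fin n → Fin m → Fin n → Carrier
  gramCoeff f i j k l = sum λ p → bilinear (f p) i j * bilinear (f p) k l

  gramCoeff-sym₁ : ∀ {m n r} (f : Vector (ProductForm m n) r) i j k l →
    gramCoeff f i j k l ≈ gramCoeff f k j i l
  gramCoeff-sym₁ f i j k l = sum-cong-≋ λ p →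
    solve 4 (λ x x′ y y′ → x :* y :* (x′ :* y′) := x′ :* y :* (x :* y′)) refl
      (proj₁ (f p) i) (proj₁ (f p) k) (proj₂ (f p) j) (proj₂ (f p) l)

  gramCoeff-sym₂ : ∀ {m n r} (f : Vector (ProductForm m n) r) i j k l →
    gramCoeff f i j k l ≈ gramCoeff f k l i j
  gramCoeff-sym₂ f i j k l = sum-cong-≋ λ p →
    *-comm (bilinear (f p) i j) (bilinear (f p) k l)

  evalGram-extremal : ∀ m x y →
    (sum λ i → sum λ k → sum λ j → sum λ l →
      gramCoeff (extremal m) i j k l * x i * x k * y j * y l) ≈
    sum λ p → evalBilinear (bilinear (extremal m p)) x y * evalBilinear (bilinear (extremal m p)) x y
  evalGram-extremal m = evalGram (λ p → bilinear (extremal m p))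

  extremal-minimal : ∀ m r (g : Vector (Fin m → Fin 3 → Carrier) r) →
    (∀ x y →
      (sum λ i → sum λ k → sum λ j → sum λ l →
        gramCoeff (extremal m) i j k l * x i * x k * y j * y l) ≈
      sum λ p → evalBilinear (g p) x y * evalBilinear (g p) x y) →
    m ℕ.+ m ℕ.≤ r
  extremal-minimal m r g P≈ = 2m≤r g λ x y →
    trans (sym (P≈ x y)) (trans (evalGram-extremal m x y) (sum-extremal m x y))

open import Defs
open import Data.List.Base using (List; []; _∷_; length; lookup)
open import Data.List.Membership.Propositional using (_∈_; _∉_)
open import Data.List.Membership.Propositional.Properties using (∈-lookup)
import Data.List.Membership.DecPropositional as DecMembership
open import Data.List.Relation.Binary.Disjoint.Propositional using (Disjoint)
open import Data.List.Relation.Unary.All as All using (All; []; _∷_)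
open import Data.List.Relation.Unary.AllPairs using ([]; _∷_)
open import Data.List.Relation.Unary.Any as Any using (here; there)
open import Data.List.Relation.Unary.Linked using (_∷_)
open import Data.List.Relation.Unary.Unique.Propositional using (Unique)
import Data.List.Relation.Unary.Unique.DecPropositional as DecUnique
open ≡ using (refl)

-- The real numbers as a ring

-- The ring identities hold term by term in ℚ and are all lifted this way; only the congruences of
-- addition and multiplication and the equivalence laws call for ε-arguments.
pointwise : ∀ {x y} → (∀ n → seq x n ≡ seq y n) → x ≈ y
pointwise {x} {y} eq = mk≈ λ ε 0<ε → 0 , λ n _ →
  ≡.subst (ℚ._< ε) (≡.sym (≡.trans (≡.cong (λ q → ∣ q ℚ.- seq y n ∣) (eq n))
    (≡.cong ∣_∣ (ℚ.+-inverseʳ (seq y n))))) 0<ε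

0<½* : ∀ {ε} → 0ℚ ℚ.< ε → 0ℚ ℚ.< ½ ℚ.* ε
0<½* {ε} 0<ε = ≡.subst (ℚ._< ½ ℚ.* ε) (ℚ.*-zeroʳ ½) (ℚ.*-monoʳ-<-pos ½ 0<ε)

½*+½* : ∀ ε → ½ ℚ.* ε ℚ.+ ½ ℚ.* ε ≡ ε
½*+½* ε = ≡.trans (≡.sym (ℚ.*-distribʳ-+ ε ½ ½)) (ℚ.*-identityˡ ε)

-- The common ε/2 argument behind transitivity and the congruence of addition.
halves-close : ∀ {x x′ y y′ z z′} → x ≈ x′ → y ≈ y′ →
  (∀ n → ∣ seq z n ℚ.- seq z′ n ∣
           ℚ.≤ ∣ seq x n ℚ.- seq x′ n ∣ ℚ.+ ∣ seq y n ℚ.- seq y′ n ∣) →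
  z ≈ z′
halves-close p q dom = mk≈ λ ε 0<ε →
  let M , P = close p (½ ℚ.* ε) (0<½* 0<ε)
      N , Q = close q (½ ℚ.* ε) (0<½* 0<ε)
  in M ⊔ N , λ n ≤n → ℚ.≤-<-trans (dom n)
       (≡.subst (_ ℚ.<_) (½*+½* ε)
         (ℚ.+-mono-< (P n (ℕ.m⊔n≤o⇒m≤o M N ≤n)) (Q n (ℕ.m⊔n≤o⇒n≤o M N ≤n))))

triangle : ∀ p q {r} → r ≡ p ℚ.+ q → ∣ r ∣ ℚ.≤ ∣ p ∣ ℚ.+ ∣ q ∣
triangle p q refl = ℚ.∣p+q∣≤∣p∣+∣q∣ p q

≈-refl : ∀ {x} → x ≈ x
≈-refl = pointwise λ _ → refl

≈-sym : ∀ {x y} → x ≈ y → y ≈ x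
≈-sym {x} {y} p = mk≈ λ ε 0<ε →
  let N , P = close p ε 0<ε
  in N , λ n N≤n → ≡.subst (ℚ._< ε) (∣p-q∣≡∣q-p∣ (seq x n) (seq y n)) (P n N≤n)
  where
  open ℚ.+-*-Solver
  ∣p-q∣≡∣q-p∣ : ∀ p q → ∣ p ℚ.- q ∣ ≡ ∣ q ℚ.- p ∣
  ∣p-q∣≡∣q-p∣ p q = ≡.trans (≡.sym (ℚ.∣-p∣≡∣p∣ (p ℚ.- q)))
    (≡.cong ∣_∣ (solve 2 (λ p q → :- (p :- q) := q :- p) refl p q))

≈-trans : ∀ {x y z} → x ≈ y → y ≈ z → x ≈ z
≈-trans {x} {y} {z} p q = halves-close p q λ n →
  triangle (seq x n ℚ.- seq y n) (seq y n ℚ.- seq z n)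
           (telescope (seq x n) (seq y n) (seq z n))
  where
  open ℚ.+-*-Solver
  telescope : ∀ p q r → p ℚ.- r ≡ (p ℚ.- q) ℚ.+ (q ℚ.- r)
  telescope = solve 3 (λ p q r → p :- r := (p :- q) :+ (q :- r)) refl

+-cong : ∀ {x x′ y y′} → x ≈ x′ → y ≈ y′ → x + y ≈ x′ + y′
+-cong {x} {x′} {y} {y′} p q = halves-close p q λ n →
  triangle (seq x n ℚ.- seq x′ n) (seq y n ℚ.- seq y′ n)
           (regroup (seq x n) (seq x′ n) (seq y n) (seq y′ n))
  where
  open ℚ.+-*-Solver
  regroup : ∀ p p′ q q′ → (p ℚ.+ q) ℚ.- (p′ ℚ.+ q′) ≡ (p ℚ.- p′) ℚ.+ (q ℚ.- q′)
  regroup = solve 4 (λ p p′ q q′ → (p :+ q) :- (p′ :+ q′) := (p :- p′) :+ (q :- q′)) refl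

eventually-bounded : ∀ x →
  ∃[ N ] ∃[ B ] 0ℚ ℚ.< B × (∀ n → N ℕ.≤ n → ∣ seq x n ∣ ℚ.≤ B)
eventually-bounded x with cauchy x 1ℚ (ℚ.positive⁻¹ 1ℚ)
... | N , near = N , 1ℚ ℚ.+ ∣ seq x N ∣
    , ℚ.+-mono-<-≤ (ℚ.positive⁻¹ 1ℚ) (ℚ.0≤∣p∣ (seq x N))
    , λ n N≤n → ℚ.≤-trans (triangle (seq x n ℚ.- seq x N) (seq x N) (split (seq x n) (seq x N)))
                          (ℚ.+-monoˡ-≤ ∣ seq x N ∣ (ℚ.<⇒≤ (near n N N≤n ℕ.≤-refl)))
  where
  open ℚ.+-*-Solver
  split : ∀ p q → p ≡ (p ℚ.- q) ℚ.+ q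
  split = solve 2 (λ p q → p := (p :- q) :+ q) refl

divide : ∀ {B ε} → 0ℚ ℚ.< B → 0ℚ ℚ.< ε → ∃[ δ ] 0ℚ ℚ.< δ × B ℚ.* δ ≡ ε
divide {B} {ε} 0<B 0<ε = B⁻¹ ℚ.* ε
  , ≡.subst (ℚ._< B⁻¹ ℚ.* ε) (ℚ.*-zeroʳ B⁻¹) (ℚ.*-monoʳ-<-pos B⁻¹ {{B⁻¹>0}} 0<ε)
  , ≡.trans (≡.sym (ℚ.*-assoc B B⁻¹ ε))
      (≡.trans (≡.cong (ℚ._* ε) (ℚ.*-inverseʳ B {{B≢0}})) (ℚ.*-identityˡ ε))
  where
  B≢0 : ℚ.NonZero B
  B≢0 = ℚ.pos⇒nonZero B {{ℚ.positive 0<B}}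
  B⁻¹ : ℚ
  B⁻¹ = (1/ B) {{B≢0}}
  B⁻¹>0 : ℚ.Positive B⁻¹
  B⁻¹>0 = ℚ.1/pos⇒pos B {{ℚ.positive 0<B}}

scale : ∀ {p q B δ} → 0ℚ ℚ.< B → ∣ p ∣ ℚ.≤ B → ∣ q ∣ ℚ.< δ → ∣ p ℚ.* q ∣ ℚ.< B ℚ.* δ
scale {p} {q} {B} {δ} 0<B p≤B q<δ = begin-strict
  ∣ p ℚ.* q ∣      ≡⟨ ℚ.∣p*q∣≡∣p∣*∣q∣ p q ⟩
  ∣ p ∣ ℚ.* ∣ q ∣  ≤⟨ ℚ.*-monoʳ-≤-nonNeg ∣ q ∣ {{ℚ.∣-∣-nonNeg q}} p≤B ⟩
  B ℚ.* ∣ q ∣      <⟨ ℚ.*-monoʳ-<-pos B {{ℚ.positive 0<B}} q<δ ⟩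
  B ℚ.* δ          ∎
  where open ℚ.≤-Reasoning

-- Eventually x stays below some bound B, so it suffices that y and y′ are within ε/B of each other.
*-congˡ : ∀ {x y y′} → y ≈ y′ → x * y ≈ x * y′
*-congˡ {x} {y} {y′} p = mk≈ λ ε 0<ε →
  let M , B , 0<B , x≤B = eventually-bounded x
      δ , 0<δ , Bδ≡ε = divide {B} 0<B 0<ε
      N , y≈y′ = close p δ 0<δ
  in M ⊔ N , λ n ≤n →
    ≡.subst₂ (λ d e → ∣ d ∣ ℚ.< e) (expand (seq x n) (seq y n) (seq y′ n)) Bδ≡ε
      (scale {seq x n} {seq y n ℚ.- seq y′ n} 0<B
        (x≤B n (ℕ.m⊔n≤o⇒m≤o M N ≤n)) (y≈y′ n (ℕ.m⊔n≤o⇒n≤o M N ≤n)))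
  where
  open ℚ.+-*-Solver
  expand : ∀ p q r → p ℚ.* (q ℚ.- r) ≡ p ℚ.* q ℚ.- p ℚ.* r
  expand = solve 3 (λ p q r → p :* (q :- r) := p :* q :- p :* r) refl

*-comm : ∀ x y → x * y ≈ y * x
*-comm x y = pointwise λ n → ℚ.*-comm (seq x n) (seq y n)

*-cong : ∀ {x x′ y y′} → x ≈ x′ → y ≈ y′ → x * y ≈ x′ * y′
*-cong {x} {x′} {y} {y′} p q =
  ≈-trans {x * y} {x * y′} {x′ * y′} (*-congˡ {x} {y} {y′} q)
    (≈-trans {x * y′} {y′ * x} {x′ * y′} (*-comm x y′)
      (≈-trans {y′ * x} {y′ * x′} {x′ * y′} (*-congˡ {y′} {x} {x′} p) (*-comm y′ x′)))

1ℝ : ℝ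
1ℝ = fromℚ 1ℚ

-- Since ℝ has η, two sums or products of reals that differ syntactically
-- are compared through their Cauchy proofs, which is not feasible.  Opaque
-- operations are compared argument by argument.

opaque
  infixl 6 _⊕_
  infixl 7 _⊗_
  infix  8 ⊖_

  _⊕_ _⊗_ : ℝ → ℝ → ℝ
  _⊕_ = _+_
  _⊗_ = _*_

  -- As a product with -1, negation inherits its Cauchy proof and its congruence from
  -- multiplication.
  ⊖_ : ℝ → ℝ
  ⊖ x = fromℚ (ℚ.- 1ℚ) * x

  -- The bridges to the opaque operations include a congruence, so that nested expressions can be
  -- converted from the inside out.
  +≈⊕ : ∀ {x x′ y y′} → x ≈ x′ → y ≈ y′ → x + y ≈ x′ ⊕ y′
  +≈⊕ {x} {x′} {y} {y′} = +-cong {x} {x′} {y} {y′}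

  *≈⊗ : ∀ {x x′ y y′} → x ≈ x′ → y ≈ y′ → x * y ≈ x′ ⊗ y′
  *≈⊗ {x} {x′} {y} {y′} = *-cong {x} {x′} {y} {y′}

  seq-⊕ : ∀ x y n → seq (x ⊕ y) n ≡ seq x n ℚ.+ seq y n
  seq-⊕ x y n = refl

  seq-⊗ : ∀ x y n → seq (x ⊗ y) n ≡ seq x n ℚ.* seq y n
  seq-⊗ x y n = refl

  ⊕-cong : ∀ {x x′ y y′} → x ≈ x′ → y ≈ y′ → x ⊕ y ≈ x′ ⊕ y′
  ⊕-cong {x} {x′} {y} {y′} = +-cong {x} {x′} {y} {y′}

  ⊗-cong : ∀ {x x′ y y′} → x ≈ x′ → y ≈ y′ → x ⊗ y ≈ x′ ⊗ y′
  ⊗-cong {x} {x′} {y} {y′} = *-cong {x} {x′} {y} {y′}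

  ⊖-cong : ∀ {x y} → x ≈ y → ⊖ x ≈ ⊖ y
  ⊖-cong {x} {y} = *-congˡ {fromℚ (ℚ.- 1ℚ)} {x} {y}

  ⊖-inverseˡ : ∀ x → ⊖ x ⊕ x ≈ 0ℝ
  ⊖-inverseˡ x = pointwise λ n →
    solve 1 (λ p → con (ℚ.- 1ℚ) :* p :+ p := con 0ℚ) refl (seq x n)
    where open ℚ.+-*-Solver

  ⊖-inverseʳ : ∀ x → x ⊕ ⊖ x ≈ 0ℝ
  ⊖-inverseʳ x = pointwise λ n →
    solve 1 (λ p → p :+ con (ℚ.- 1ℚ) :* p := con 0ℚ) refl (seq x n)
    where open ℚ.+-*-Solver

  ⊕-assoc : ∀ x y z → (x ⊕ y) ⊕ z ≈ x ⊕ (y ⊕ z)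
  ⊕-assoc x y z = pointwise λ n → ℚ.+-assoc (seq x n) (seq y n) (seq z n)

  ⊕-comm : ∀ x y → x ⊕ y ≈ y ⊕ x
  ⊕-comm x y = pointwise λ n → ℚ.+-comm (seq x n) (seq y n)

  ⊕-identityˡ : ∀ x → 0ℝ ⊕ x ≈ x
  ⊕-identityˡ x = pointwise λ n → ℚ.+-identityˡ (seq x n)

  ⊕-identityʳ : ∀ x → x ⊕ 0ℝ ≈ x
  ⊕-identityʳ x = pointwise λ n → ℚ.+-identityʳ (seq x n)

  ⊗-assoc : ∀ x y z → (x ⊗ y) ⊗ z ≈ x ⊗ (y ⊗ z)
  ⊗-assoc x y z = pointwise λ n → ℚ.*-assoc (seq x n) (seq y n) (seq z n)

  ⊗-comm : ∀ x y → x ⊗ y ≈ y ⊗ x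
  ⊗-comm x y = pointwise λ n → ℚ.*-comm (seq x n) (seq y n)

  ⊗-identityˡ : ∀ x → 1ℝ ⊗ x ≈ x
  ⊗-identityˡ x = pointwise λ n → ℚ.*-identityˡ (seq x n)

  ⊗-identityʳ : ∀ x → x ⊗ 1ℝ ≈ x
  ⊗-identityʳ x = pointwise λ n → ℚ.*-identityʳ (seq x n)

  ⊗-distribˡ-⊕ : ∀ x y z → x ⊗ (y ⊕ z) ≈ x ⊗ y ⊕ x ⊗ z
  ⊗-distribˡ-⊕ x y z = pointwise λ n → ℚ.*-distribˡ-+ (seq x n) (seq y n) (seq z n)

  ⊗-distribʳ-⊕ : ∀ x y z → (y ⊕ z) ⊗ x ≈ y ⊗ x ⊕ z ⊗ x
  ⊗-distribʳ-⊕ x y z = pointwise λ n → ℚ.*-distribʳ-+ (seq x n) (seq y n) (seq z n)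

ℝ-commutativeRing : CommutativeRing 0ℓ 0ℓ
ℝ-commutativeRing = record
  { Carrier = ℝ ; _≈_ = _≈_ ; _+_ = _⊕_ ; _*_ = _⊗_ ; -_ = ⊖_ ; 0# = 0ℝ ; 1# = 1ℝ
  ; isCommutativeRing = record
    { isRing = record
      { +-isAbelianGroup = record
        { isGroup = record
          { isMonoid = record
            { isSemigroup = record
              { isMagma = record
                { isEquivalence = record { refl = ≈-refl ; sym = ≈-sym ; trans = ≈-trans }
                ; ∙-cong = ⊕-cong }
              ; assoc = ⊕-assoc }
            ; identity = ⊕-identityˡ , ⊕-identityʳ }
          ; inverse = ⊖-inverseˡ , ⊖-inverseʳ
          ; ⁻¹-cong = ⊖-cong }
        ; comm = ⊕-comm }
      ; *-cong = ⊗-cong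
      ; *-assoc = ⊗-assoc
      ; *-identity = ⊗-identityˡ , ⊗-identityʳ
      ; distrib = ⊗-distribˡ-⊕ , ⊗-distribʳ-⊕ }
    ; *-comm = ⊗-comm } }

-- A property of the representing sequence, not of the real number: it is not invariant under `_≈_`,
-- but 0, 1, sums and squares have it.
NonNegative : ℝ → Set
NonNegative x = ∀ n → 0ℚ ℚ.≤ seq x n

≈0-close : ∀ {x} → x ≈ 0ℝ → ∀ ε → 0ℚ ℚ.< ε → ∃[ N ] ∀ n → N ℕ.≤ n → ∣ seq x n ∣ ℚ.< ε
≈0-close {x} x≈0 ε 0<ε =
  let N , near = close x≈0 ε 0<ε
  in N , λ n N≤n → ≡.subst (λ q → ∣ q ∣ ℚ.< ε) (ℚ.+-identityʳ (seq x n)) (near n N≤n)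

close-≈0 : ∀ {x} → (∀ ε → 0ℚ ℚ.< ε → ∃[ N ] ∀ n → N ℕ.≤ n → ∣ seq x n ∣ ℚ.< ε) → x ≈ 0ℝ
close-≈0 {x} small = mk≈ λ ε 0<ε →
  let N , near = small ε 0<ε
  in N , λ n N≤n → ≡.subst (λ q → ∣ q ∣ ℚ.< ε) (≡.sym (ℚ.+-identityʳ (seq x n))) (near n N≤n)

square-nonNegativeℚ : ∀ q → 0ℚ ℚ.≤ q ℚ.* q
square-nonNegativeℚ q with ℚ.≤-total 0ℚ q
... | inj₁ 0≤q = ℚ.nonNegative⁻¹ _ {{ℚ.nonNeg*nonNeg⇒nonNeg q {{ℚ.nonNegative 0≤q}} q {{ℚ.nonNegative 0≤q}}}}
... | inj₂ q≤0 = ℚ.nonNegative⁻¹ _ {{ℚ.nonPos*nonPos⇒nonPos q {{ℚ.nonPositive q≤0}} q {{ℚ.nonPositive q≤0}}}}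

⊕-nonNegative : ∀ {x y} → NonNegative x → NonNegative y → NonNegative (x ⊕ y)
⊕-nonNegative {x} {y} x≥0 y≥0 n =
  ≡.subst (0ℚ ℚ.≤_) (≡.sym (seq-⊕ x y n)) (ℚ.+-mono-≤ (x≥0 n) (y≥0 n))

square-nonNegative : ∀ x → NonNegative (x ⊗ x)
square-nonNegative x n =
  ≡.subst (0ℚ ℚ.≤_) (≡.sym (seq-⊗ x x n)) (square-nonNegativeℚ (seq x n))

-- Since the terms are non-negative, each term of x is bounded in absolute value by the matching
-- term of the sum.
⊕-≈0 : ∀ {x y} → NonNegative x → NonNegative y → x ⊕ y ≈ 0ℝ → x ≈ 0ℝ
⊕-≈0 {x} {y} x≥0 y≥0 x+y≈0 = close-≈0 λ ε 0<ε →
  let N , near = ≈0-close x+y≈0 ε 0<ε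
  in N , λ n N≤n → ℚ.≤-<-trans (dominated (x≥0 n) (y≥0 n))
                     (≡.subst (λ q → ∣ q ∣ ℚ.< ε) (seq-⊕ x y n) (near n N≤n))
  where
  dominated : ∀ {p q} → 0ℚ ℚ.≤ p → 0ℚ ℚ.≤ q → ∣ p ∣ ℚ.≤ ∣ p ℚ.+ q ∣
  dominated {p} {q} 0≤p 0≤q = ≡.subst₂ ℚ._≤_
    (≡.sym (ℚ.0≤p⇒∣p∣≡p 0≤p)) (≡.sym (ℚ.0≤p⇒∣p∣≡p (ℚ.+-mono-≤ 0≤p 0≤q)))
    (≡.subst (ℚ._≤ p ℚ.+ q) (ℚ.+-identityʳ p) (ℚ.+-monoʳ-≤ p 0≤q))

∣∣-square-cancel-< : ∀ {ε q} → 0ℚ ℚ.< ε → ∣ q ℚ.* q ∣ ℚ.< ε ℚ.* ε → ∣ q ∣ ℚ.< ε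
∣∣-square-cancel-< {ε} {q} 0<ε qq<εε with ∣ q ∣ ℚ.<? ε
... | yes q<ε = q<ε
... | no  q≮ε = contradiction (ℚ.≤-<-trans εε≤qq qq<εε) (ℚ.<-irrefl refl)
  where
  open ℚ.≤-Reasoning
  ε≤q : ε ℚ.≤ ∣ q ∣
  ε≤q = ℚ.≮⇒≥ q≮ε
  εε≤qq : ε ℚ.* ε ℚ.≤ ∣ q ℚ.* q ∣
  εε≤qq = begin
    ε ℚ.* ε          ≤⟨ ℚ.*-monoˡ-≤-nonNeg ε {{ℚ.nonNegative (ℚ.<⇒≤ 0<ε)}} ε≤q ⟩
    ε ℚ.* ∣ q ∣      ≤⟨ ℚ.*-monoʳ-≤-nonNeg ∣ q ∣ {{ℚ.∣-∣-nonNeg q}} ε≤q ⟩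
    ∣ q ∣ ℚ.* ∣ q ∣  ≡⟨ ℚ.∣p*q∣≡∣p∣*∣q∣ q q ⟨
    ∣ q ℚ.* q ∣      ∎

-- Tolerance ε² for the square yields tolerance ε for x, since squaring is monotone on absolute
-- values.
square-≈0 : ∀ {x} → x ⊗ x ≈ 0ℝ → x ≈ 0ℝ
square-≈0 {x} xx≈0 = close-≈0 λ ε 0<ε →
  let N , near = ≈0-close xx≈0 (ε ℚ.* ε)
        (≡.subst (ℚ._< ε ℚ.* ε) (ℚ.*-zeroʳ ε) (ℚ.*-monoʳ-<-pos ε {{ℚ.positive 0<ε}} 0<ε))
  in N , λ n N≤n → ∣∣-square-cancel-< {ε} {seq x n} 0<ε
                     (≡.subst (λ q → ∣ q ∣ ℚ.< ε ℚ.* ε) (seq-⊗ x x n) (near n N≤n))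

1≉0 : ¬ 1ℝ ≈ 0ℝ
1≉0 1≈0 = let N , near = ≈0-close 1≈0 1ℚ (ℚ.positive⁻¹ 1ℚ)
          in ℚ.<-irrefl refl (near N ℕ.≤-refl)

ℝ-isNonNegativity : IsNonNegativity ℝ-commutativeRing NonNegative
ℝ-isNonNegativity = record
  { 0-nonNegative      = λ _ → ℚ.≤-refl
  ; 1-nonNegative      = λ _ → ℚ.nonNegative⁻¹ 1ℚ
  ; +-nonNegative      = λ {x} {y} → ⊕-nonNegative {x} {y}
  ; square-nonNegative = square-nonNegative
  ; +-≈0               = λ {x} {y} → ⊕-≈0 {x} {y}
  ; square-≈0          = square-≈0
  ; 1≉0                = 1≉0 }

-- Transfer of the rank computation to real biquadratic forms

module ℝ-sums = SumsOverRing ℝ-commutativeRing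
module ℝ-theory = FormallyReal ℝ-commutativeRing NonNegative ℝ-isNonNegativity
open ℝ-theory using (bilinear; extremal; gramCoeff; gramCoeff-sym₁; gramCoeff-sym₂;
  evalGram-extremal; extremal-minimal)

module R = CommutativeRing ℝ-commutativeRing
module RSum = Sums R.semiring

-- One sum is built from `_+_` and the other from the opaque `_⊕_`; their sequences can be compared
-- term by term without touching the Cauchy proofs.
seq-sum : ∀ {k} (s : Vector ℝ k) n → seq (sum s) n ≡ seq (RSum.sum s) n
seq-sum {zero}  s n = refl
seq-sum {suc k} s n = ≡.trans (≡.cong (seq (s zero) n ℚ.+_) (seq-sum (tail s) n))
  (≡.sym (seq-⊕ (s zero) (RSum.sum (tail s)) n))

sum≈ : ∀ {n} {s t : Vector ℝ n} → (∀ i → s i ≈ t i) → sum s ≈ RSum.sum t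
sum≈ {s = s} s≈t = R.trans {sum s} {RSum.sum s} (pointwise (seq-sum s)) (RSum.sum-cong-≋ s≈t)

product₃ : ∀ x y z → x * y * z ≈ x ⊗ y ⊗ z
product₃ x y z = *≈⊗ {x * y} {x ⊗ y} {z} {z} (*≈⊗ {x} {x} {y} {y} R.refl R.refl) R.refl

product₅ : ∀ x y z u v → x * y * z * u * v ≈ x ⊗ y ⊗ z ⊗ u ⊗ v
product₅ x y z u v = *≈⊗ {x * y * z * u} {x ⊗ y ⊗ z ⊗ u} {v} {v}
  (*≈⊗ {x * y * z} {x ⊗ y ⊗ z} {u} {u} (product₃ x y z) R.refl) R.refl

evalBilinear≈ : ∀ {m n} (b : BilinearForm m n) x y → evalBilinear b x y ≈ ℝ-sums.evalBilinear b x y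
evalBilinear≈ {m} {n} b x y = sum≈ {m} λ i → sum≈ {n} λ j → product₃ (b i j) (x i) (y j)

eval≈ : ∀ {m n} (P : BiquadraticForm m n) x y → let open BiquadraticForm P in
  eval x y ≈ (RSum.sum λ i → RSum.sum λ k → RSum.sum λ j → RSum.sum λ l →
    coeff i j k l ⊗ x i ⊗ x k ⊗ y j ⊗ y l)
eval≈ {m} {n} P x y = sum≈ {m} λ i → sum≈ {m} λ k → sum≈ {n} λ j → sum≈ {n} λ l →
  product₅ (BiquadraticForm.coeff P i j k l) (x i) (x k) (y j) (y l)

sum-squares≈ : ∀ {r} {s t : Vector ℝ r} → (∀ p → s p ≈ t p) →
  (sum λ p → s p * s p) ≈ (RSum.sum λ p → t p ⊗ t p)
sum-squares≈ {r} {s} {t} s≈t = sum≈ {r} λ p → *≈⊗ {s p} {t p} {s p} {t p} (s≈t p) (s≈t p)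

sum-evalBilinear²≈ : ∀ {m n r} (f : Vector (BilinearForm m n) r) (x : Vector ℝ m) (y : Vector ℝ n) →
  (sum λ p → evalBilinear (f p) x y * evalBilinear (f p) x y) ≈
  (RSum.sum λ p → ℝ-sums.evalBilinear (f p) x y ⊗ ℝ-sums.evalBilinear (f p) x y)
sum-evalBilinear²≈ {r = r} f x y = sum-squares≈ {r} 
  {λ p → evalBilinear (f p) x y} {λ p → ℝ-sums.evalBilinear (f p) x y} λ p → evalBilinear≈ (f p) x y

extremalForm : ∀ m → BiquadraticForm m 3
extremalForm m = record
  { coeff = gramCoeff (extremal m)
  ; sym₁  = gramCoeff-sym₁ (extremal m)
  ; sym₂  = gramCoeff-sym₂ (extremal m) }

-- The defining product forms give a representation with 2m squares, and `extremal-minimal` bounds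
-- every representation from below.
extremal-rank : ∀ m → HasSOSRank (extremalForm m) (m ℕ.+ m)
extremal-rank m = (f , λ x y →
    R.trans (eval≈ (extremalForm m) x y) (R.trans (evalGram-extremal m x y) (R.sym (sum-evalBilinear²≈ f x y))))
  , λ r (g , P≈) → extremal-minimal m r g λ x y →
    R.trans (R.sym (eval≈ (extremalForm m) x y)) (R.trans (P≈ x y) (sum-evalBilinear²≈ g x y))
  where f = λ p → bilinear (extremal m p)

-- The augmented graph

infix 4 _≟_ _∈?_

_≟_ : ∀ {m n} → DecidableEquality (Cell m n)
_≟_ = ≡-dec Fin._≟_ Fin._≟_

_∈?_ : ∀ {m n} (c : Cell m n) E → Dec (c ∈ E)
_∈?_ = DecMembership._∈?_ _≟_

-- The bound z(m,3) ≤ m + 3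

pair : Fin 3 → Fin 3 × Fin 3
pair 0F = 0F , 1F
pair 1F = 0F , 2F
pair 2F = 1F , 2F

pair-distinct : ∀ p → proj₁ (pair p) ≢ proj₂ (pair p)
pair-distinct 0F ()
pair-distinct 1F ()
pair-distinct 2F ()

-- A cell is charged to its row if it is the first one of E there, and
-- otherwise to the pair of columns formed with an earlier cell of that row.

data Charge {m} (E : List (Cell m 3)) : Cell m 3 → Fin m ⊎ Fin 3 → Set where
  to-row  : ∀ {i j} → (∀ {l} → l Fin.< j → (i , l) ∉ E) → Charge E (i , j) (inj₁ i)
  to-pair : ∀ {i} p → (i , proj₁ (pair p)) ∈ E → Charge E (i , proj₂ (pair p)) (inj₂ p)

charge : ∀ {m} E (c : Cell m 3) → ∃[ s ] Charge E c s
charge E (i , 0F) = inj₁ i , to-row λ ()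
charge E (i , 1F) with (i , 0F) ∈? E
... | yes i0∈E = inj₂ 0F , to-pair 0F i0∈E
... | no  i0∉E = inj₁ i , to-row λ { {0F} _ → i0∉E ; {suc _} (ℕ.s≤s ()) }
charge E (i , 2F) with (i , 0F) ∈? E | (i , 1F) ∈? E
... | yes i0∈E | _        = inj₂ 1F , to-pair 1F i0∈E
... | no  _    | yes i1∈E = inj₂ 2F , to-pair 2F i1∈E
... | no  i0∉E | no  i1∉E = inj₁ i , to-row λ { {0F} _ → i0∉E ; {1F} _ → i1∉E ; {2F} (ℕ.s≤s (ℕ.s≤s ())) }

-- A row has only one first cell, and two rows charging the same pair of columns would span a
-- 4-cycle.
charge-injective : ∀ {m} {E : List (Cell m 3)} → C₄-Free E → ∀ {c d s} →
  c ∈ E → d ∈ E → Charge E c s → Charge E d s → c ≡ d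
charge-injective free {i , j} {_ , l} c∈E d∈E (to-row c-first) (to-row d-first) with Fin.<-cmp j l
... | tri< j<l _ _ = contradiction c∈E (d-first j<l)
... | tri≈ _ refl _ = refl
... | tri> _ _ l<j = contradiction d∈E (c-first l<j)
charge-injective free {i , _} {k , _} c∈E d∈E (to-pair p c′∈E) (to-pair p d′∈E) with i Fin.≟ k
... | yes refl = refl
... | no  i≢k  = contradiction (c′∈E , c∈E , d′∈E , d∈E) (free i≢k (pair-distinct p))

lookup-injective : ∀ {A : Set} {xs : List A} → Unique xs → ∀ {p q} → lookup xs p ≡ lookup xs q → p ≡ q
lookup-injective (_ ∷ _)      {zero}  {zero}  _  = refl
lookup-injective (x≢xs ∷ _)   {zero}  {suc q} eq = contradiction eq (All.lookup x≢xs (∈-lookup q))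
lookup-injective (x≢xs ∷ _)   {suc p} {zero}  eq = contradiction (≡.sym eq) (All.lookup x≢xs (∈-lookup p))
lookup-injective (_ ∷ unique) {suc p} {suc q} eq = ≡.cong suc (lookup-injective unique eq)

-- Charging injects the cells into the m rows together with the three pairs of columns.
C₄-Free⇒length≤ : ∀ {m} {E : List (Cell m 3)} → Unique E → C₄-Free E → length E ℕ.≤ m ℕ.+ 3
C₄-Free⇒length≤ {m} {E} unique free = Fin.injective⇒≤ {f = target} target-injective
  where
  charged = λ p → charge E (lookup E p)
  target = λ p → join m 3 (proj₁ (charged p))
  target-injective : ∀ {p q} → target p ≡ target q → p ≡ q
  target-injective {p} {q} eq = lookup-injective unique
    (charge-injective free (∈-lookup p) (∈-lookup q) (proj₂ (charged p))
      (≡.subst (Charge E (lookup E q)) (≡.sym same) (proj₂ (charged q))))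
    where
    same : proj₁ (charged p) ≡ proj₁ (charged q)
    same = ≡.trans (≡.sym (Fin.splitAt-join m 3 (proj₁ (charged p))))
      (≡.trans (≡.cong (splitAt m) eq) (Fin.splitAt-join m 3 (proj₁ (charged q))))

-- The witness graph and its conditions

oneEdges : List (Cell 5 3)
oneEdges = (0F , 0F) ∷ (0F , 1F) ∷ (1F , 0F) ∷ (1F , 2F) ∷ (2F , 1F) ∷ (2F , 2F)
         ∷ (3F , 0F) ∷ (4F , 1F) ∷ []

oneEdges-unique : Unique oneEdges
oneEdges-unique = from-yes (DecUnique.unique? _≟_ oneEdges)

-- The first three rows use each pair of columns once and the last two rows hold a single cell, so
-- no pair of columns repeats; the finite check runs over all rows and columns.
oneEdges-C₄-free : C₄-Free oneEdges
oneEdges-C₄-free {i} {k} {j} {l} = from-yes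
  (Fin.all? λ i → Fin.all? λ k → Fin.all? λ j → Fin.all? λ l →
    ¬? (i Fin.≟ k) →-dec ¬? (j Fin.≟ l) →-dec
    ¬? ((i , j) ∈? oneEdges ×-dec (i , l) ∈? oneEdges ×-dec
        (k , j) ∈? oneEdges ×-dec (k , l) ∈? oneEdges)) i k j l

z[5,3]≡8 : IsZarankiewicz 5 3 8
z[5,3]≡8 = (oneEdges , oneEdges-unique , oneEdges-C₄-free , refl)
  , λ { _ (E , unique , free , refl) → C₄-Free⇒length≤ unique free }

e₃ e₄ : TwoEdge 5 3
e₃ = mk2 (3F , 1F) (3F , 2F) (inj₂ (refl , ℕ.s≤s (ℕ.s≤s ℕ.z≤n)))
e₄ = mk2 (4F , 0F) (4F , 2F) (inj₂ (refl , ℕ.s≤s ℕ.z≤n))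

graph : AugmentedGraph 5 3
graph = record
  { E₁        = oneEdges
  ; E₁-unique = oneEdges-unique
  ; E₂        = e₃ ∷ e₄ ∷ []
  ; E₂-unique = ((λ ()) ∷ []) ∷ [] ∷ [] }

open AugmentedGraph graph

disjoint? : ∀ {A : Set} → DecidableEquality A → (xs ys : List A) → Dec (Disjoint xs ys)
disjoint? _≟_ xs ys = map′ (λ xs∉ys (x∈xs , x∈ys) → All.lookup xs∉ys x∈xs x∈ys)
  (λ disjoint → All.tabulate λ x∈xs x∈ys → disjoint (x∈xs , x∈ys))
  (All.all? (λ x → ¬? (DecMembership._∈?_ _≟_ x ys)) xs)

occupied? : ∀ c → Dec (Occupied c)
occupied? c = c ∈? E₁ ⊎-dec Any.any? (λ e → c ∈? halves e) E₂

vertexDisjoint? : ∀ {m n} (e f : Edge m n) → Dec (VertexDisjoint e f)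
vertexDisjoint? e f = disjoint? Fin._≟_ (rows e) (rows f) ×-dec disjoint? Fin._≟_ (cols e) (cols f)

oppositeCell? : ∀ {m n} (e f : Edge m n) c → Dec (OppositeCell e f c)
oppositeCell? e f c =
  (DecMembership._∈?_ Fin._≟_ (row c) (rows e) ×-dec DecMembership._∈?_ Fin._≟_ (col c) (cols f)) ⊎-dec
  (DecMembership._∈?_ Fin._≟_ (row c) (rows f) ×-dec DecMembership._∈?_ Fin._≟_ (col c) (cols e))

E₂-degenerate : ∀ {e} → e ∈ E₂ → ¬ Nondegenerate e
E₂-degenerate e∈E₂ (rows≢ , _) = rows≢ 
  (All.lookup {P = λ e → row (half₁ e) ≡ row (half₂ e)} (refl ∷ refl ∷ []) e∈E₂)

graph-S : S
graph-S = (λ e∈E₂ → All.lookup (All.lookup halves∉E₁ e∈E₂)) , disjoint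
  where
  halves∉E₁ : All (λ e → All (_∉ E₁) (halves e)) E₂
  halves∉E₁ = from-yes (All.all? (λ e → All.all? (λ c → ¬? (c ∈? E₁)) (halves e)) E₂)
  disjoint : ∀ {e f} → e ∈ E₂ → f ∈ E₂ → e ≢ f → Disjoint (halves e) (halves f)
  disjoint (here refl)         (here refl)         e≢f = contradiction refl e≢f
  disjoint (here refl)         (there (here refl)) _   = from-yes (disjoint? _≟_ (halves e₃) (halves e₄))
  disjoint (there (here refl)) (here refl)         _   = from-yes (disjoint? _≟_ (halves e₄) (halves e₃))
  disjoint (there (here refl)) (there (here refl)) e≢f = contradiction refl e≢f

-- Every arc starts at a nondegenerate 2-edge, and both 2-edges lie within a row. The case split on
-- `vs` only exposes the first arc.
graph-W2 : W2
graph-W2 {vs = []}    (_ , ((e∈E₂ , nondegenerate) , _) ∷ _) = contradiction nondegenerate (E₂-degenerate e∈E₂)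
graph-W2 {vs = _ ∷ _} (_ , ((e∈E₂ , nondegenerate) , _) ∷ _) = contradiction nondegenerate (E₂-degenerate e∈E₂)

graph-W2′ : W2′
graph-W2′ e∈E₂ nondegenerate _ = E₂-degenerate e∈E₂ nondegenerate

-- An edge vertex-disjoint from a 2-edge here is a 1-edge in the one column that the 2-edge misses
-- and in one of the first three rows. The unoccupied cell of that row then lies in a column of the
-- 2-edge.
graph-W3 : W3
graph-W3 e∈E₂ f∈edges disjoint =
  let i , j , opposite , unoccupied = All.lookup (All.lookup unoccupied-opposite e∈E₂) f∈edges disjoint
  in (i , j) , opposite , unoccupied
  where
  -- The cell is quantified by its two coordinates, so that the decision procedure searches rows and
  -- columns separately.
  unoccupied-opposite : All (λ e → All (λ f → VertexDisjoint (two e) f →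
    ∃[ i ] ∃[ j ] OppositeCell (two e) f (i , j) × ¬ Occupied (i , j)) edges) E₂
  unoccupied-opposite = from-yes (All.all? (λ e → All.all? (λ f → vertexDisjoint? (two e) f →-dec
    Fin.any? λ i → Fin.any? λ j → oppositeCell? (two e) f (i , j) ×-dec ¬? (occupied? (i , j))) edges) E₂)

zwL≥10 : zwLSizes 5 3 10
zwL≥10 = graph , graph-S , oneEdges-C₄-free , graph-W2 , graph-W2′ , graph-W3 , z[5,3]≡8 , refl

theorem11 : (10 ≤max zwLSizes 5 3) × (10 ≤max SOSRanks 5 3)
-- The graph has size 8 + 2, and the rank bound is witnessed directly by the extremal form with five
-- rows, of rank 5 + 5.
theorem11 = (10 , zwL≥10 , ℕ.≤-refl) , (10 , (extremalForm 5 , extremal-rank 5) , ℕ.≤-refl)
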